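{- Let $\Delta\geq 3$ be an integer and let $A$ be a deterministic adaptive priority algorithm for maximum matching in the vertex model (as described in the context). Then for every $\varepsilon>0$ there is a graph $G$ of maximum degree at most $\Delta$ such that the matching computed by $A$ on input $G$ has size at most $\left(\frac{\Delta-1}{2\Delta-3}+\varepsilon\right)|M^*|$, where $M^*$ is a maximum matching of $G$.
   Context: Input model: the input graph $G$ is presented as a set of adjacency lists (data items) $\langle u; v_1,\dots,v_d\rangle$, one per node $u$, listing the node's identifier followed by the identifiers of its neighbors in arbitrary order. The algorithm knows the number of nodes of $G$ in advance and starts with an empty matching. A node is isolated if it is matched or all of its neighbors are matched. In each step the algorithm, possibly using everything it has learned so far, specifies a total priority order on all possible adjacency lists; it then receives the adjacency list of highest priority among those corresponding to still non-isolated nodes of $G$, say of node $u$, and irrevocably matches $u$ with a neighbor of $u$ of its choice that is not yet matched. Adjacency lists are never modified (matched nodes remain in them). This continues until all nodes are isolated. The adversary chooses the graph. -}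

module Defs where

open import Level using (0ℓ)
open import Data.Nat.Base as ℕ using (ℕ; NonZero; _∸_)
import Data.Nat.Properties as ℕ
open import Data.Integer.Base using (+_)
open import Data.Rational.Base using (ℚ; _/_)
open import Data.Fin.Base using (Fin)
open import Data.List.Base using (List; []; _∷_; length; map; concatMap)
open import Data.List.Membership.Propositional using (_∈_; _∉_)
open import Data.List.Relation.Unary.All using (All)
open import Data.List.Relation.Unary.Unique.Propositional using (Unique)
open import Data.Product.Base using (Σ-syntax; _×_; _,_; proj₁)
open import Data.Sum.Base using (_⊎_)
open import Relation.Binary.Core using (Rel)
open import Relation.Binary.Structures using (IsTotalOrder)
open import Relation.Binary.PropositionalEquality using (_≡_; refl; cong)
open import Relation.Nullary.Negation using (¬_; contradiction)

-- A finite simple graph on Fin n, presented by adjacency lists; the order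
-- of each list is part of the presentation, since an algorithm sees it.
record Graph (n : ℕ) : Set where
  field
    neighbors : Fin n → List (Fin n)
    distinct  : ∀ u → Unique (neighbors u)
    loopless  : ∀ u → u ∉ neighbors u
    symmetric : ∀ {u v} → v ∈ neighbors u → u ∈ neighbors v

open Graph public

MaxDegree≤ : ∀ {n} → Graph n → ℕ → Set
MaxDegree≤ G Δ = ∀ u → length (neighbors G u) ℕ.≤ Δ

Edge : ℕ → Set
Edge n = Fin n × Fin n

covered : ∀ {n} → List (Edge n) → List (Fin n)
covered = concatMap (λ (u , v) → u ∷ v ∷ [])

IsMatching : ∀ {n} → Graph n → List (Edge n) → Set
IsMatching G M = All (λ (u , v) → v ∈ neighbors G u) M × Unique (covered M)

IsMaximumMatching : ∀ {n} → Graph n → List (Edge n) → Set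
IsMaximumMatching G M =
  IsMatching G M × (∀ M′ → IsMatching G M′ → length M′ ℕ.≤ length M)

-- ⟨ u ; v₁ , … , v_d ⟩
Item : ℕ → Set
Item n = Fin n × List (Fin n)

item : ∀ {n} → Graph n → Fin n → Item n
item G u = u , neighbors G u

-- The items received so far, each with the partner chosen for its node, most
-- recent first.  The algorithm is deterministic, so its earlier priority
-- orders (and hence what it may infer from items it was not given) are
-- functions of this data.
History : ℕ → Set
History n = List (Item n × Fin n)

matching : ∀ {n} → History n → List (Edge n)
matching = map (λ ((u , _) , v) → u , v)

Isolated : ∀ {n} → List (Edge n) → Item n → Set
Isolated M (u , vs) = u ∈ covered M ⊎ All (_∈ covered M) vs

-- The parameter n makes the number of nodes known in advance.
record PriorityAlgorithm (n : ℕ) : Set₁ where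
  field
    -- Lower h x y: after history h, item y has priority at least that of x.
    Lower        : History n → Rel (Item n) 0ℓ
    isTotalOrder : ∀ h → IsTotalOrder _≡_ (Lower h)
    choose       : History n → Item n → Fin n
    choose-valid : ∀ h u vs → ¬ Isolated (matching h) (u , vs) →
                   choose h (u , vs) ∈ vs × choose h (u , vs) ∉ covered (matching h)

module _ {n} (A : PriorityAlgorithm n) (G : Graph n) where
  open PriorityAlgorithm A

  Received : History n → Fin n → Set
  Received h u =
    ¬ Isolated (matching h) (item G u) ×
    (∀ w → ¬ Isolated (matching h) (item G w) → Lower h (item G w) (item G u))

  -- Run h h′: continuing from history h, the algorithm halts with history h′.
  data Run : History n → History n → Set where
    halt : ∀ {h} → (∀ u → Isolated (matching h) (item G u)) → Run h h
    step : ∀ {h h′} u → Received h u →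
           Run ((item G u , choose h (item G u)) ∷ h) h′ → Run h h′

  Run-functional : ∀ {h h₁ h₂} → Run h h₁ → Run h h₂ → h₁ ≡ h₂
  Run-functional (halt _) (halt _) = refl
  Run-functional (halt all) (step u (¬iso , _) _) = contradiction (all u) ¬iso
  Run-functional (step u (¬iso , _) _) (halt all) = contradiction (all u) ¬iso
  Run-functional {h} (step u (¬isoᵤ , maxᵤ) r₁) (step w (¬isoʷ , maxʷ) r₂)
    with cong proj₁ (IsTotalOrder.antisym (isTotalOrder h) (maxʷ u ¬isoᵤ) (maxᵤ w ¬isoʷ))
  ... | refl = Run-functional r₁ r₂

  Computes : List (Edge n) → Set
  Computes M = Σ[ h ∈ History n ] (Run [] h × M ≡ matching h)

2Δ∸3-nonZero : ∀ {Δ} → 3 ℕ.≤ Δ → NonZero (2 ℕ.* Δ ∸ 3)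
2Δ∸3-nonZero {Δ} 3≤Δ = ℕ.>-nonZero (ℕ.m<n⇒0<n∸m
  (ℕ.≤-trans (ℕ.m≤m+n 4 2) (ℕ.*-monoʳ-≤ 2 3≤Δ)))

ratio : (Δ : ℕ) → 3 ℕ.≤ Δ → ℚ
ratio Δ 3≤Δ = (+ (Δ ∸ 1)) / (2 ℕ.* Δ ∸ 3)
  where instance _ = 2Δ∸3-nonZero 3≤Δ

size : ∀ {n} → List (Edge n) → ℚ
size M = + length M / 1

{-# OPTIONS --safe #-}
module Submission where

-- The adversary offers the algorithm only items with at least two unmatched
-- neighbours, and fixes the graph around each item u it gives out after seeing
-- the partner v chosen for u.  Each of the first Δ − 3 steps makes every other
-- unmatched neighbour y of u adjacent to exactly u and v, hence isolated.  If
-- there are two such y, the optimum matches u and v into them; if there is only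
-- one, v becomes "needy" and is promised a private partner in the last gadget.
-- In the next step the other unmatched neighbours Y of u and fresh neighbours Q
-- of v, Δ nodes in all, become the leaves of a star around a fresh centre t, and
-- distinct leaves are attached to the needy nodes; the algorithm gets just one
-- more edge out of the star.  It ends with Δ − 1 edges, while an optimum has
-- 2 (Δ − 2) + 1: every u, every v and t form a vertex cover of that size.

open import Data.Nat.Base using (ℕ; _≤_; _<_; zero; suc; _+_; _*_; _∸_; z≤n; s≤s; NonZero)
import Data.Nat.Properties as ℕ
open import Data.Nat.Tactic.RingSolver using (solve-∀)
open import Data.Bool.Base using (if_then_else_)
import Data.Integer.Base as ℤ
import Data.Integer.Tactic.RingSolver as ℤ
import Data.Rational.Base as ℚ
import Data.Rational.Properties as ℚ
import Data.Rational.Unnormalised.Base as ℚᵘ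
import Data.Rational.Unnormalised.Properties as ℚᵘ
open import Data.Fin.Base using (Fin)
open import Data.Fin.Properties using (_≟_)
open import Data.List.Base
  using (List; []; _∷_; _++_; length; filter; map; zip; allFin; cartesianProduct; cartesianProductWith)
open import Data.List.Properties
  using (length-++; filter-notAll; length-zipWith; length-map; length-tabulate)
open import Data.List.Membership.Propositional using (_∈_; _∉_; find; lose)
open import Data.List.Membership.Propositional.Properties
  using (∈-∃++; ∈-++⁺ˡ; ∈-++⁺ʳ; ∈-++⁻; ∈-filter⁺; ∈-filter⁻; ∈-allFin; ∈-map⁻; ∈-map⁺; ∈-length;
         ∈-cartesianProduct⁺; ∈-cartesianProductWith⁺)
open import Data.List.Relation.Binary.Subset.Propositional using (_⊆_)
open import Data.List.Relation.Unary.All as All using (All; []; _∷_)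
open import Data.List.Relation.Unary.All.Properties using (¬Any⇒All¬; All¬⇒¬Any)
  renaming (++⁺ to All++⁺)
open import Data.List.Relation.Unary.Any as Any using (Any; here; there)
import Data.List.Relation.Unary.AllPairs as AllPairs
open import Data.List.Relation.Unary.AllPairs using ([]; _∷_)
open import Data.List.Relation.Unary.Unique.Propositional using (Unique)
open import Data.List.Relation.Unary.Unique.Propositional.Properties
  using (Unique[x∷xs]⇒x∉xs; filter⁺; allFin⁺; ++⁺)
open import Data.Product.Base using (Σ-syntax; ∃-syntax; ∃₂; _×_; _,_; proj₁; proj₂)
open import Data.Sum.Base using (_⊎_; inj₁; inj₂; [_,_]′)
import Data.List.Extrema as Extrema
open import Function.Base using (id; _∘_; const)
open import Relation.Binary.Bundles using (TotalOrder)
open import Relation.Binary.PropositionalEquality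
  using (_≡_; _≢_; refl; sym; trans; cong; subst; subst₂; ≢-sym; module ≡-Reasoning)
open import Relation.Nullary.Decidable using (Dec; yes; no; does; ¬?; _×-dec_; _⊎-dec_)
open import Relation.Nullary.Negation using (¬_; contradiction)
open import Relation.Unary using (Decidable)
open import Defs

-- Lists without repetition

module _ {A : Set} where

  ∷-unique : {x : A} {xs : List A} → x ∉ xs → Unique xs → Unique (x ∷ xs)
  ∷-unique x∉xs uniq = ¬Any⇒All¬ _ x∉xs ∷ uniq

  -- Induction on `xs`: one occurrence of `x` is deleted from `ys`, and the tail of `xs` still lies
  -- in what remains because `x` does not recur in it.
  unique-⊆⇒length-≤ : {xs ys : List A} → Unique xs → xs ⊆ ys → length xs ≤ length ys
  unique-⊆⇒length-≤ {[]}     _ _ = z≤n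
  unique-⊆⇒length-≤ {x ∷ xs} uniq@(_ ∷ uniq′) xs⊆ys with ∈-∃++ (xs⊆ys (here refl))
  ... | as , bs , refl = begin
    suc (length xs)              ≤⟨ s≤s (unique-⊆⇒length-≤ uniq′ xs⊆as++bs) ⟩
    suc (length (as ++ bs))      ≡⟨ cong suc (length-++ as) ⟩
    suc (length as + length bs)  ≡⟨ ℕ.+-suc (length as) (length bs) ⟨
    length as + suc (length bs)  ≡⟨ length-++ as ⟨
    length (as ++ x ∷ bs)        ∎
    where
    open ℕ.≤-Reasoning
    xs⊆as++bs : xs ⊆ as ++ bs
    xs⊆as++bs z∈xs with ∈-++⁻ as (xs⊆ys (there z∈xs))
    ... | inj₁ z∈as          = ∈-++⁺ˡ z∈as
    ... | inj₂ (here refl)   = contradiction z∈xs (Unique[x∷xs]⇒x∉xs uniq)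
    ... | inj₂ (there z∈bs)  = ∈-++⁺ʳ as z∈bs

  singleton-or-pair : {xs : List A} {x : A} → Unique xs → x ∈ xs →
                      length xs ≡ 1 ⊎ ∃[ y ] (y ∈ xs × y ≢ x)
  singleton-or-pair {_ ∷ []} _ _ = inj₁ refl
  singleton-or-pair {x ∷ y ∷ _} uniq (here refl) =
    inj₂ (y , there (here refl) , λ { refl → Unique[x∷xs]⇒x∉xs uniq (here refl) })
  singleton-or-pair {y ∷ _ ∷ _} uniq (there x∈xs) =
    inj₂ (y , here refl , λ { refl → Unique[x∷xs]⇒x∉xs uniq x∈xs })

  ∈-∉⇒≢ : {x y : A} {zs : List A} → x ∈ zs → y ∉ zs → x ≢ y
  ∈-∉⇒≢ x∈zs y∉zs refl = y∉zs x∈zs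

  choose-sublist : ∀ m {xs : List A} → Unique xs → m ≤ length xs →
                   ∃[ ys ] (ys ⊆ xs × Unique ys × length ys ≡ m)
  choose-sublist zero _ _ = [] , (λ ()) , [] , refl
  choose-sublist (suc m) {x ∷ xs} uniq@(_ ∷ uniq′) (s≤s m≤) with choose-sublist m uniq′ m≤
  ... | ys , ys⊆xs , uniqʸ , eq =
    x ∷ ys , (λ { (here p) → here p ; (there p) → there (ys⊆xs p) }) ,
    ∷-unique (Unique[x∷xs]⇒x∉xs uniq ∘ ys⊆xs) uniqʸ , cong suc eq

  -- Distributes the leaves of the last star: `xs` are those around `u`, `ys` those around `v`. In
  -- the optimum `x₁`, `y₁` and `z` are matched with `u`, `v` and the centre, while `rest` supplies
  -- partners for the `m` needy nodes.
  record Picks (xs ys : List A) (m : ℕ) : Set where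
    field
      x₁ y₁ z     : A
      rest        : List A
      x₁∈xs       : x₁ ∈ xs
      y₁∈ys       : y₁ ∈ ys
      z∈          : z ∈ xs ++ ys
      rest⊆       : rest ⊆ xs ++ ys
      unique      : Unique (x₁ ∷ y₁ ∷ z ∷ rest)
      rest-length : m ≤ length rest

  picks : ∀ {xs ys m} → Unique xs → Unique ys → (∀ {x} → x ∈ xs → x ∉ ys) →
          0 < length xs → 0 < length ys → 3 + m ≤ length xs + length ys → Picks xs ys m
  picks {x ∷ xs} {y ∷ ys} {m} uniqˣ@(_ ∷ uniqˣ′) uniqʸ@(_ ∷ uniqʸ′) disjoint _ _ bound =
    build (xs ++ ys) id enough others-unique
    where
    enough : suc m ≤ length (xs ++ ys)
    enough = ℕ.+-cancelˡ-≤ 2 _ _ (subst (3 + m ≤_)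
      (cong suc (trans (ℕ.+-suc (length xs) (length ys)) (cong suc (sym (length-++ xs))))) bound)
    others-unique : Unique (x ∷ y ∷ xs ++ ys)
    others-unique =
      ∷-unique (λ { (here refl) → disjoint (here refl) (here refl)
                  ; (there p) → [ Unique[x∷xs]⇒x∉xs uniqˣ , disjoint (here refl) ∘ there ]′ (∈-++⁻ xs p) })
      (∷-unique (λ p → [ (λ q → disjoint (there q) (here refl)) , Unique[x∷xs]⇒x∉xs uniqʸ ]′ (∈-++⁻ xs p))
      (++⁺ uniqˣ′ uniqʸ′ λ (p , q) → disjoint (there p) (there q)))
    widen : xs ++ ys ⊆ (x ∷ xs) ++ y ∷ ys
    widen p = [ ∈-++⁺ˡ ∘ there , ∈-++⁺ʳ (x ∷ xs) ∘ there ]′ (∈-++⁻ xs p)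
    -- Generalising `xs ++ ys` to a variable `zs` allows its head to be split off as `z`, which may
    -- come from either side.
    build : ∀ zs → zs ⊆ xs ++ ys → suc m ≤ length zs → Unique (x ∷ y ∷ zs) → Picks (x ∷ xs) (y ∷ ys) m
    build (z ∷ rest) zs⊆ (s≤s m≤) unique = record
      { x₁ = x ; y₁ = y ; z = z ; rest = rest
      ; x₁∈xs       = here refl
      ; y₁∈ys       = here refl
      ; z∈          = widen (zs⊆ (here refl))
      ; rest⊆       = widen ∘ zs⊆ ∘ there
      ; unique      = unique
      ; rest-length = m≤
      }

  -- Bounding the length leaves finitely many adjacency lists, so that an item of highest priority
  -- can be found by search.
  listsUpTo : ℕ → List A → List (List A)
  listsUpTo zero    xs = [] ∷ []
  listsUpTo (suc k) xs = [] ∷ cartesianProductWith _∷_ xs (listsUpTo k xs)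

  ∈-listsUpTo : ∀ {k xs} {ys : List A} → length ys ≤ k → ys ⊆ xs → ys ∈ listsUpTo k xs
  ∈-listsUpTo {zero}  {ys = []}    _       _     = here refl
  ∈-listsUpTo {suc k} {ys = []}    _       _     = here refl
  ∈-listsUpTo {suc k} {ys = _ ∷ _} (s≤s p) ys⊆xs =
    there (∈-cartesianProductWith⁺ _∷_ (ys⊆xs (here refl)) (∈-listsUpTo p (ys⊆xs ∘ there)))

-- Matchings, vertex covers and pairings of nodes

module _ {n : ℕ} where

  open import Data.List.Membership.DecPropositional (_≟_ {n}) using (_∈?_)
  open import Data.List.Relation.Unary.Unique.DecPropositional (_≟_ {n}) using (unique?)

  Node : Set
  Node = Fin n

  -- Weak duality: every edge of `M` has an end in `C`, and these ends are distinct because `M` is a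
  -- matching. `ends` keeps the selected ends within `covered M`, which makes each new one fresh.
  vertex-cover⇒length-≤ : {G : Graph n} {C : List Node} →
    (∀ {w x} → x ∈ neighbors G w → w ∈ C ⊎ x ∈ C) →
    ∀ M → IsMatching G M → length M ≤ length C
  vertex-cover⇒length-≤ {G} {C} covers M (edges , uniq) =
    let E , len , uniqE , E⊆ = ends M edges uniq
    in subst (_≤ length C) len (unique-⊆⇒length-≤ uniqE (proj₁ ∘ E⊆))
    where
    ends : ∀ M → All (λ (u , v) → v ∈ neighbors G u) M → Unique (covered M) →
           ∃[ E ] (length E ≡ length M × Unique E × (∀ {x} → x ∈ E → x ∈ C × x ∈ covered M))
    ends [] _ _ = [] , refl , [] , λ ()
    ends ((a , b) ∷ M) (ab ∷ edges) (a∉ ∷ b∉ ∷ uniq) with ends M edges uniq | covers ab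
    ... | E , len , uniqE , E⊆ | inj₁ a∈C =
      a ∷ E , cong suc len ,
      ∷-unique (λ a∈E → All¬⇒¬Any a∉ (there (proj₂ (E⊆ a∈E)))) uniqE ,
      λ { (here refl) → a∈C , here refl
        ; (there p)   → proj₁ (E⊆ p) , there (there (proj₂ (E⊆ p))) }
    ... | E , len , uniqE , E⊆ | inj₂ b∈C =
      b ∷ E , cong suc len ,
      ∷-unique (λ b∈E → All¬⇒¬Any b∉ (proj₂ (E⊆ b∈E))) uniqE ,
      λ { (here refl) → b∈C , there (here refl)
        ; (there p)   → proj₁ (E⊆ p) , there (there (proj₂ (E⊆ p))) }

  -- Opaque so that the node can be inferred from the term override S f g x.
  opaque

    override : List Node → (Node → List Node) → (Node → List Node) → Node → List Node
    override S f g x = if does (x ∈? S) then f x else g x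

    override-∈ : ∀ S f g {x} → x ∈ S → override S f g x ≡ f x
    override-∈ S f g {x} x∈S with x ∈? S
    ... | yes _   = refl
    ... | no x∉S  = contradiction x∈S x∉S

    override-∉ : ∀ S f g {x} → x ∉ S → override S f g x ≡ g x
    override-∉ S f g {x} x∉S with x ∈? S
    ... | yes x∈S = contradiction x∈S x∉S
    ... | no _    = refl

  -- The pairing `zip rs vs` as adjacency lists, seen from the side of `rs`. In the star `vs` are
  -- the needy nodes; they receive the reverse edges through `att`, at the earlier step that made
  -- them needy.
  partner : List Node → List Node → Node → List Node
  partner (r ∷ rs) (v ∷ vs) x = if does (x ≟ r) then v ∷ [] else partner rs vs x
  partner _        _        x = []

  partner-⊆ : ∀ rs vs x → partner rs vs x ⊆ vs
  partner-⊆ (r ∷ rs) (v ∷ vs) x p with x ≟ r | p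
  ... | yes _ | here refl = here refl
  ... | no _  | p′        = there (partner-⊆ rs vs x p′)

  partner-length : ∀ rs vs x → length (partner rs vs x) ≤ 1
  partner-length []       _        x = z≤n
  partner-length (r ∷ rs) []       x = z≤n
  partner-length (r ∷ rs) (v ∷ vs) x with x ≟ r
  ... | yes _ = s≤s z≤n
  ... | no _  = partner-length rs vs x

  partner-unique : ∀ rs vs x → Unique (partner rs vs x)
  partner-unique []       _        x = []
  partner-unique (r ∷ rs) []       x = []
  partner-unique (r ∷ rs) (v ∷ vs) x with x ≟ r
  ... | yes _ = [] ∷ []
  ... | no _  = partner-unique rs vs x

  -- Since `v` occurs once in `vs`, at most one node is paired with it. This bounds the degree that
  -- a needy node gains in the star.
  partner-source : ∀ rs {vs v} → Unique vs → v ∈ vs →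
                   ∃[ r ] (∀ {x} → v ∈ partner rs vs x → x ≡ r)
  -- No list contains `v` here, so any node will do as `r`.
  partner-source [] {v = v} _ _ = v , λ ()
  partner-source (r ∷ rs) {v ∷ vs} uniq (here refl) = r , only
    where
    only : ∀ {x} → v ∈ partner (r ∷ rs) (v ∷ vs) x → x ≡ r
    only {x} p with x ≟ r
    ... | yes x≡r = x≡r
    ... | no _           = contradiction (partner-⊆ rs vs x p) (Unique[x∷xs]⇒x∉xs uniq)
  partner-source (r ∷ rs) {v′ ∷ vs} {v} uniq@(_ ∷ uniq′) (there v∈vs) = proj₁ ih , only
    where
    ih = partner-source rs uniq′ v∈vs
    only : ∀ {x} → v ∈ partner (r ∷ rs) (v′ ∷ vs) x → x ≡ proj₁ ih
    only {x} p with x ≟ r | p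
    ... | yes _ | here refl = contradiction v∈vs (Unique[x∷xs]⇒x∉xs uniq)
    ... | no _  | p′        = proj₂ ih p′

  partner-edges : ∀ {rs vs} → Unique rs →
                  All (λ (r , v) → r ∈ rs × v ∈ partner rs vs r) (zip rs vs)
  partner-edges {[]}              _ = []
  partner-edges {_ ∷ _}  {[]}     _ = []
  partner-edges {r ∷ rs} {v ∷ vs} uniq@(_ ∷ uniq′) =
    (here refl , hit) ∷
    All.map (λ (x∈rs , y∈) → there x∈rs , miss x∈rs y∈) (partner-edges uniq′)
    where
    hit : v ∈ partner (r ∷ rs) (v ∷ vs) r
    hit with r ≟ r
    ... | yes _  = here refl
    ... | no r≢r = contradiction refl r≢r
    miss : ∀ {x y} → x ∈ rs → y ∈ partner rs vs x → y ∈ partner (r ∷ rs) (v ∷ vs) x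
    miss {x} x∈rs y∈ with x ≟ r
    ... | yes refl = contradiction x∈rs (Unique[x∷xs]⇒x∉xs uniq)
    ... | no _     = y∈

  covered-zip-⊆ : ∀ {rs vs : List Node} {x} → x ∈ covered (zip rs vs) → x ∈ rs ⊎ x ∈ vs
  covered-zip-⊆ {_ ∷ _} {_ ∷ _} (here refl)         = inj₁ (here refl)
  covered-zip-⊆ {_ ∷ _} {_ ∷ _} (there (here refl)) = inj₂ (here refl)
  covered-zip-⊆ {_ ∷ _} {_ ∷ _} (there (there p))   =
    [ inj₁ ∘ there , inj₂ ∘ there ]′ (covered-zip-⊆ p)

  covered-zip-unique : ∀ {rs vs : List Node} → Unique rs → Unique vs → (∀ {x} → x ∈ rs → x ∉ vs) →
                       Unique (covered (zip rs vs))
  covered-zip-unique {[]}             _ _ _ = []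
  covered-zip-unique {_ ∷ _} {[]}     _ _ _ = []
  covered-zip-unique {r ∷ _} {v ∷ _} uniqʳ@(_ ∷ uniqʳ′) uniqᵛ@(_ ∷ uniqᵛ′) disj =
    ∷-unique (λ { (here refl) → disj (here refl) (here refl)
                ; (there p) → [ Unique[x∷xs]⇒x∉xs uniqʳ
                              , disj (here refl) ∘ there ]′ (covered-zip-⊆ p) })
    (∷-unique (λ p → [ (λ q → disj (there q) (here refl))
                     , Unique[x∷xs]⇒x∉xs uniqᵛ ]′ (covered-zip-⊆ p))
      (covered-zip-unique uniqʳ′ uniqᵛ′ λ p q → disj (there p) (there q)))

  length-zip : ∀ (rs vs : List Node) → length vs ≤ length rs → length (zip rs vs) ≡ length vs
  length-zip rs vs vs≤rs = trans (length-zipWith _,_ rs vs) (ℕ.m≥n⇒m⊓n≡n vs≤rs)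

  covered-⊆ : {P : Node → Set} {M : List (Edge n)} → All (λ (a , b) → P a × P b) M →
              ∀ {x} → x ∈ covered M → P x
  covered-⊆ ((pa , _) ∷ _) (here refl)         = pa
  covered-⊆ ((_ , pb) ∷ _) (there (here refl)) = pb
  covered-⊆ (_ ∷ ps)       (there (there p))   = covered-⊆ ps p

  Isolated-mono : ∀ {M e i} → Isolated {n} M i → Isolated (e ∷ M) i
  Isolated-mono (inj₁ p)  = inj₁ (there (there p))
  Isolated-mono (inj₂ ps) = inj₂ (All.map (there ∘ there) ps)

  -- The adversary: admissible items, states and completions

  module Adversary (A : PriorityAlgorithm n) (Δ : ℕ) where
    open PriorityAlgorithm A

    totalOrder : History n → TotalOrder _ _ _
    totalOrder h = record { isTotalOrder = isTotalOrder h }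

    greatest : ∀ h i is → ∃[ j ] (j ∈ i ∷ is × All (λ j′ → Lower h j′ j) (i ∷ is))
    greatest h i is = max i is , [ here , there ]′ (argmax-sel id i is) , ⊥≤max i is ∷ xs≤max i is
      where open Extrema (totalOrder h)

    -- Histories are formed from planned lists before the graph exists; this turns them into steps
    -- of a run once the graph agrees with the plan.
    Run-step : ∀ {G h h′ u l} → neighbors G u ≡ l → Received A G h u →
               Run A G (((u , l) , choose h (u , l)) ∷ h) h′ → Run A G h h′
    Run-step refl = step _

    -- With two entries in `W`, at least one is left after the partner is chosen, so that `Y` is
    -- nonempty. The nested `Any` makes the condition decidable by searching `l`.
    Two : List Node → List Node → Set
    Two W l = Any (λ a → Any (λ b → a ≢ b × a ∈ W × b ∈ W) l) l

    two : ∀ {W l a b} → a ≢ b → a ∈ W → b ∈ W → a ∈ l → b ∈ l → Two W l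
    two a≢b a∈W b∈W a∈l b∈l = lose a∈l (lose b∈l (a≢b , a∈W , b∈W))

    Two-mono : ∀ {W W′ l} → W ⊆ W′ → Two W l → Two W′ l
    Two-mono W⊆W′ = Any.map (Any.map λ (a≢b , a∈W , b∈W) → a≢b , W⊆W′ a∈W , W⊆W′ b∈W)

    -- W are the nodes about which nothing is fixed yet; V are the matched nodes
    -- whose items are never revealed and which may still receive neighbours.
    record Admissible (W V : List Node) (i : Item n) : Set where
      constructor admissible
      field
        alive   : proj₁ i ∈ W
        uniq    : Unique (proj₂ i)
        noloop  : proj₁ i ∉ proj₂ i
        inside  : All (λ x → x ∈ W ⊎ x ∈ V) (proj₂ i)
        degree  : length (proj₂ i) ≤ Δ
        choices : Two W (proj₂ i)

    admissible? : ∀ W V → Decidable (Admissible W V)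
    admissible? W V (u , l) with u ∈? W ×-dec unique? l ×-dec ¬? (u ∈? l)
      ×-dec All.all? (λ x → x ∈? W ⊎-dec x ∈? V) l ×-dec length l ℕ.≤? Δ
      ×-dec Any.any? (λ a → Any.any? (λ b → ¬? (a ≟ b) ×-dec a ∈? W ×-dec b ∈? W) l) l
    ... | yes (a , b , c , d , e , f) = yes (admissible a b c d e f)
    ... | no ¬p = no λ (admissible a b c d e f) → ¬p (a , b , c , d , e , f)

    -- There are finitely many candidates, since `degree` bounds the lists. The given `i` is the
    -- default of the argmax and is itself admissible.
    greatest-admissible : ∀ h {W V i} → Admissible W V i →
      ∃[ j ] (Admissible W V j × (∀ {j′} → Admissible W V j′ → Lower h j′ j))
    greatest-admissible h {W} {V} {i} adm
      with greatest h i (filter (admissible? W V) (cartesianProduct (allFin n) (listsUpTo Δ (allFin n))))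
    ... | j , j∈ , _ ∷ top = j , accepted j∈ ,
      λ adm′ → All.lookup top (∈-filter⁺ (admissible? W V)
        (∈-cartesianProduct⁺ (∈-allFin _)
          (∈-listsUpTo (Admissible.degree adm′) λ _ → ∈-allFin _)) adm′)
      where
      accepted : j ∈ i ∷ filter (admissible? W V) (cartesianProduct (allFin n) (listsUpTo Δ (allFin n))) →
                 Admissible W V j
      accepted (here refl) = adm
      accepted (there p)   = proj₂ (∈-filter⁻ (admissible? W V)
                               {xs = cartesianProduct (allFin n) (listsUpTo Δ (allFin n))} p)

    -- `k` is the number of early steps still ahead. In `supply`, an early step uses up `u`, `v` and
    -- `Y`, at most `suc Δ` nodes, and the last step needs `u`, `v`, the centre and `Δ` leaves.
    -- `budget` leaves room for the degree of a new needy node and, once `k` is 0, yields at least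
    -- three more leaves than needy nodes.
    record State (k : ℕ) (h : History n) (W V : List Node) : Set where
      field
        alive-unique    : Unique W
        alive-uncovered : ∀ {w} → w ∈ W → w ∉ covered (matching h)
        needy-unique    : Unique V
        needy-covered   : ∀ {v} → v ∈ V → v ∈ covered (matching h)
        supply          : k * suc Δ + (3 + Δ) ≤ length W
        budget          : 3 + k + length V ≤ Δ

      alive⇒¬needy : ∀ {w} → w ∈ W → w ∉ V
      alive⇒¬needy w∈W w∈V = alive-uncovered w∈W (needy-covered w∈V)

    -- The graph on `W`, as fixed by following the algorithm from `h` to its end. Edges between `W`
    -- and `V` are recorded on the side of `W`. In `attached`, a needy node may be listed by the `u`
    -- of each of the `k + 1` gadgets to come and by its private partner. An edge into `V` may
    -- escape `cover`, because the needy node itself joins the cover at the step that made it needy.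
    -- `run` ranges over all `G` extending the plan, since the lists outside `W` are settled
    -- elsewhere.
    record Completion (k : ℕ) (h : History n) (W V : List Node) : Set where
      field
        nbrs            : Node → List Node
        permitted       : ∀ {w} → w ∈ W → nbrs w ≡ [] ⊎ Admissible W V (w , nbrs w)
        symm            : ∀ {w x} → w ∈ W → x ∈ W → x ∈ nbrs w → w ∈ nbrs x
        attached        : ∀ {v} → v ∈ V → ∃[ B ] (length B ≤ 2 + k × (∀ {w} → w ∈ W → v ∈ nbrs w → w ∈ B))
        optimum         : List (Edge n)
        optimum-edges   : All (λ (a , b) → a ∈ W × b ∈ nbrs a) optimum
        optimum-unique  : Unique (covered optimum)
        optimum-length  : length optimum ≡ 3 + (k + k) + length V
        cover           : List Node
        cover-length    : length cover ≡ 3 + (k + k)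
        covers          : ∀ {w x} → w ∈ W → x ∈ nbrs w → w ∈ cover ⊎ x ∈ cover ⊎ x ∈ V
        final           : History n
        final-length    : length final ≡ 2 + k + length h
        run             : ∀ {G} → (∀ {w} → w ∈ W → neighbors G w ≡ nbrs w) →
                          (∀ {w} → w ∉ W → Isolated (matching h) (item G w)) → Run A G h final

      nbrs-inside : ∀ {w x} → w ∈ W → x ∈ nbrs w → x ∈ W ⊎ x ∈ V
      nbrs-inside w∈W x∈ with permitted w∈W
      ... | inj₁ eq  = contradiction (subst (_ ∈_) eq x∈) λ ()
      ... | inj₂ adm = All.lookup (Admissible.inside adm) x∈

      optimum-inside : ∀ {x} → x ∈ covered optimum → x ∈ W ⊎ x ∈ V
      optimum-inside = covered-⊆ (All.map (λ (a∈W , b∈) → inj₁ a∈W , nbrs-inside a∈W b∈) optimum-edges)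

    -- One item received and its partner chosen

    module Reception {k h W V} (S : State k h W V) {u l} (adm : Admissible W V (u , l))
                     (top : ∀ {j} → Admissible W V j → Lower h j (u , l)) where
      open State S
      open Admissible adm renaming (alive to u∈W; uniq to l-unique; noloop to u∉l)

      v : Node
      v = choose h (u , l)

      h⁺ : History n
      h⁺ = ((u , l) , v) ∷ h

      ¬isolated : ¬ Isolated (matching h) (u , l)
      ¬isolated (inj₁ p)  = alive-uncovered u∈W p
      ¬isolated (inj₂ ps) =
        let a , a∈l , any = find choices
            _ , _ , _ , a∈W , _ = find any
        in alive-uncovered a∈W (All.lookup ps a∈l)

      v∈l : v ∈ l
      v∈l = proj₁ (choose-valid h u l ¬isolated)

      -- An entry of `l` outside `W` is needy, hence covered, whereas the algorithm must choose an
      -- uncovered partner.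
      v∈W : v ∈ W
      v∈W with All.lookup inside v∈l
      ... | inj₁ p = p
      ... | inj₂ p = contradiction (needy-covered p) (proj₂ (choose-valid h u l ¬isolated))

      u≢v : u ≢ v
      u≢v u≡v = u∉l (subst (_∈ l) (sym u≡v) v∈l)

      other? : Decidable (λ x → x ∈ W × x ≢ v)
      other? x = x ∈? W ×-dec ¬? (x ≟ v)

      Y : List Node
      Y = filter other? l

      Y-unique : Unique Y
      Y-unique = filter⁺ other? l-unique

      Y⁻ : ∀ {y} → y ∈ Y → y ∈ l × y ∈ W × y ≢ v
      Y⁻ = ∈-filter⁻ other? {xs = l}

      Y⊆W : Y ⊆ W
      Y⊆W = proj₁ ∘ proj₂ ∘ Y⁻

      Y⊆l : Y ⊆ l
      Y⊆l = proj₁ ∘ Y⁻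

      u∉Y : u ∉ Y
      u∉Y = u∉l ∘ Y⊆l

      v∉Y : v ∉ Y
      v∉Y p = proj₂ (proj₂ (Y⁻ p)) refl

      l∩W : ∀ {x} → x ∈ l → x ∈ W → x ≡ v ⊎ x ∈ Y
      l∩W {x} x∈l x∈W with x ≟ v
      ... | yes eq = inj₁ eq
      ... | no x≢v = inj₂ (∈-filter⁺ other? x∈l (x∈W , x≢v))

      Y-nonempty : ∃[ y ] y ∈ Y
      Y-nonempty with find choices
      ... | a , a∈l , any with find any
      ...   | b , b∈l , a≢b , a∈W , b∈W with l∩W a∈l a∈W | l∩W b∈l b∈W
      ...     | inj₂ a∈Y | _         = a , a∈Y
      ...     | inj₁ _   | inj₂ b∈Y  = b , b∈Y
      ...     | inj₁ a≡v | inj₁ b≡v  = contradiction (trans a≡v (sym b≡v)) a≢b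

      Y-length : length Y < Δ
      Y-length = ℕ.≤-trans (filter-notAll other? l (lose v∈l λ (_ , v≢v) → v≢v refl)) degree

      rest? : Decidable (λ x → x ∉ u ∷ v ∷ Y)
      rest? x = ¬? (x ∈? (u ∷ v ∷ Y))

      W⁺ : List Node
      W⁺ = filter rest? W

      W⁺⁻ : ∀ {w} → w ∈ W⁺ → w ∈ W × w ∉ u ∷ v ∷ Y
      W⁺⁻ = ∈-filter⁻ rest? {xs = W}

      W⁺⊆W : W⁺ ⊆ W
      W⁺⊆W = proj₁ ∘ W⁺⁻

      u∉W⁺ : u ∉ W⁺
      u∉W⁺ p = proj₂ (W⁺⁻ p) (here refl)

      v∉W⁺ : v ∉ W⁺
      v∉W⁺ p = proj₂ (W⁺⁻ p) (there (here refl))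

      Y∉W⁺ : ∀ {y} → y ∈ Y → y ∉ W⁺
      Y∉W⁺ y∈Y p = proj₂ (W⁺⁻ p) (there (there y∈Y))

      data Part (w : Node) : Set where
        is-u : w ≡ u → Part w
        is-v : w ≡ v → Part w
        in-Y : w ∈ Y → Part w
        in-W⁺ : w ∈ W⁺ → Part w

      part : ∀ {w} → w ∈ W → Part w
      part {w} w∈W with w ∈? (u ∷ v ∷ Y)
      ... | yes (here eq)          = is-u eq
      ... | yes (there (here eq))  = is-v eq
      ... | yes (there (there p))  = in-Y p
      ... | no ∉                   = in-W⁺ (∈-filter⁺ rest? w∈W ∉)

      W⁺-unique : Unique W⁺
      W⁺-unique = filter⁺ rest? alive-unique

      W⁺-length : length W ≤ 2 + length Y + length W⁺
      W⁺-length = subst (length W ≤_) (length-++ (u ∷ v ∷ Y))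
        (unique-⊆⇒length-≤ alive-unique λ w∈W → split (part w∈W))
        where
        split : ∀ {w} → Part w → w ∈ (u ∷ v ∷ Y) ++ W⁺
        split (is-u refl) = here refl
        split (is-v refl) = there (here refl)
        split (in-Y p)    = ∈-++⁺ˡ (there (there p))
        split (in-W⁺ p)   = ∈-++⁺ʳ (u ∷ v ∷ Y) p

      uncovered⁺ : ∀ {w} → w ∈ W → w ≢ u → w ≢ v → w ∉ covered (matching h⁺)
      uncovered⁺ _   w≢u _   (here eq)          = w≢u eq
      uncovered⁺ _   _   w≢v (there (here eq))  = w≢v eq
      uncovered⁺ w∈W _   _   (there (there p))  = alive-uncovered w∈W p

      W⁺-uncovered : ∀ {w} → w ∈ W⁺ → w ∉ covered (matching h⁺)
      W⁺-uncovered w∈W⁺ = uncovered⁺ (W⁺⊆W w∈W⁺) (λ { refl → u∉W⁺ w∈W⁺ }) (λ { refl → v∉W⁺ w∈W⁺ })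

      -- The item of `u` was maximal among all admissible items before the graph was fixed. Hence it
      -- comes first in any graph whose lists on `W` are admissible or empty: nodes with empty lists
      -- and nodes outside `W` are isolated.
      received : ∀ {N : Node → List Node} {G} →
        N u ≡ l → (∀ {w} → w ∈ W → N w ≡ [] ⊎ Admissible W V (w , N w)) →
        (∀ {w} → w ∈ W → neighbors G w ≡ N w) →
        (∀ {w} → w ∉ W → Isolated (matching h) (item G w)) → Received A G h u
      received {N} {G} Nu≡l permitted agree isolated =
        subst (λ l → ¬ Isolated (matching h) (u , l)) (sym eq) ¬isolated ,
        λ w ¬iso → subst (λ l → Lower h (item G w) (u , l)) (sym eq) (lower w ¬iso)
        where
        eq : neighbors G u ≡ l
        eq = trans (agree u∈W) Nu≡l
        lower : ∀ w → ¬ Isolated (matching h) (item G w) → Lower h (item G w) (u , l)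
        lower w ¬iso with w ∈? W
        ... | no w∉W = contradiction (isolated w∉W) ¬iso
        ... | yes w∈W with permitted w∈W
        ...   | inj₁ empty = contradiction
          (inj₂ (subst (All _) (sym (trans (agree w∈W) empty)) [])) ¬iso
        ...   | inj₂ adm′ = top (subst (λ l → Admissible W V (w , l)) (sym (agree w∈W)) adm′)

    -- The early gadgets

    module Early {k h W V} (S : State (suc k) h W V) {u l} (adm : Admissible W V (u , l))
                 (top : ∀ {j} → Admissible W V j → Lower h j (u , l)) where
      open State S
      open Admissible adm renaming (alive to u∈W; uniq to l-unique; noloop to u∉l)
      open Reception S adm top

      -- If v still has spare degree, it becomes needy; otherwise Y has two
      -- nodes, which serve as the partners of u and v in the optimum.
      data Grow (y₁ : Node) : List Node → Set where
        needy : length Y ≡ 1 → Grow y₁ (v ∷ V)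
        full  : ∀ {y₂} → y₂ ∈ Y → y₂ ≢ y₁ → Grow y₁ V

      module _ {y₁} (y₁∈Y : y₁ ∈ Y) where

        v∉V : v ∉ V
        v∉V = alive⇒¬needy v∈W

        V⁺⊆ : ∀ {V⁺} → Grow y₁ V⁺ → V⁺ ⊆ v ∷ V
        V⁺⊆ (needy _)  = id
        V⁺⊆ (full _ _) = there

        V⊆V⁺ : ∀ {V⁺} → Grow y₁ V⁺ → V ⊆ V⁺
        V⊆V⁺ (needy _)  = there
        V⊆V⁺ (full _ _) = id

        next : ∀ {V⁺} → Grow y₁ V⁺ → State k h⁺ W⁺ V⁺
        next {V⁺} g = record
          { alive-unique    = W⁺-unique
          ; alive-uncovered = W⁺-uncovered
          ; needy-unique    = V⁺-unique g
          ; needy-covered   = λ p → needy-covered⁺ (V⁺⊆ g p)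
          ; supply          = ℕ.+-cancelˡ-≤ (suc Δ) _ _ (begin
              suc Δ + (k * suc Δ + (3 + Δ))  ≡⟨ ℕ.+-assoc (suc Δ) (k * suc Δ) (3 + Δ) ⟨
              suc k * suc Δ + (3 + Δ)        ≤⟨ supply ⟩
              length W                       ≤⟨ W⁺-length ⟩
              2 + length Y + length W⁺       ≤⟨ ℕ.+-monoˡ-≤ (length W⁺) (s≤s Y-length) ⟩
              suc Δ + length W⁺              ∎)
          ; budget          = begin
              3 + k + length V⁺       ≤⟨ ℕ.+-monoʳ-≤ (3 + k) (V⁺-length g) ⟩
              3 + k + suc (length V)  ≡⟨ ℕ.+-suc (3 + k) (length V) ⟩
              3 + suc k + length V    ≤⟨ budget ⟩
              Δ                       ∎
          }
          where
          open ℕ.≤-Reasoning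
          V⁺-unique : ∀ {V⁺} → Grow y₁ V⁺ → Unique V⁺
          V⁺-unique (needy _)  = ∷-unique v∉V needy-unique
          V⁺-unique (full _ _) = needy-unique
          V⁺-length : ∀ {V⁺} → Grow y₁ V⁺ → length V⁺ ≤ suc (length V)
          V⁺-length (needy _)  = ℕ.≤-refl
          V⁺-length (full _ _) = ℕ.n≤1+n _
          needy-covered⁺ : ∀ {x} → x ∈ v ∷ V → x ∈ covered (matching h⁺)
          needy-covered⁺ (here refl) = there (here refl)
          needy-covered⁺ (there p)   = there (there (needy-covered p))

        spare : ∀ {V⁺} → Grow y₁ V⁺ → (length Y ≡ 1 × v ∈ V⁺) ⊎ v ∉ V⁺
        spare (needy one) = inj₁ (one , here refl)
        spare (full _ _)  = inj₂ v∉V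

        extra : ∀ {V⁺} → Grow y₁ V⁺ → List (Edge n)
        extra (needy _)           = (y₁ , u) ∷ []
        extra (full {y₂} _ _)     = (y₁ , u) ∷ (y₂ , v) ∷ []

        -- Both `u` and `v` get a partner in the optimum in either case: a needy `v` gets it inside
        -- the completion, where it is counted in `V⁺`.
        extra-length : ∀ {V⁺} (g : Grow y₁ V⁺) → length (extra g) + length V⁺ ≡ 2 + length V
        extra-length (needy _)  = refl
        extra-length (full _ _) = refl

        extra-edges : ∀ {V⁺} {P : Edge n → Set} (g : Grow y₁ V⁺) →
                      (∀ {y} → y ∈ Y → P (y , u)) → (∀ {y} → y ∈ Y → P (y , v)) → All P (extra g)
        extra-edges (needy _)      pu pv = pu y₁∈Y ∷ []
        extra-edges (full y₂∈Y _)  pu pv = pu y₁∈Y ∷ pv y₂∈Y ∷ []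

        Y-fresh : ∀ {V⁺ y} → Grow y₁ V⁺ → y ∈ Y → ¬ (y ∈ W⁺ ⊎ y ∈ V⁺)
        Y-fresh g y∈Y (inj₁ y∈W⁺) = Y∉W⁺ y∈Y y∈W⁺
        Y-fresh g y∈Y (inj₂ y∈V⁺) with V⁺⊆ g y∈V⁺
        ... | here refl = v∉Y y∈Y
        ... | there y∈V = alive⇒¬needy (Y⊆W y∈Y) y∈V

        u-fresh : ∀ {V⁺} → Grow y₁ V⁺ → ¬ (u ∈ W⁺ ⊎ u ∈ V⁺)
        u-fresh g (inj₁ u∈W⁺) = u∉W⁺ u∈W⁺
        u-fresh g (inj₂ u∈V⁺) with V⁺⊆ g u∈V⁺
        ... | here u≡v  = u≢v u≡v
        ... | there u∈V = alive⇒¬needy u∈W u∈V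

        -- The matching of the completion stays within `W⁺` and `V⁺`, which avoid `u` and `Y`, and
        -- also `v` when `v` is full.
        extra-unique : ∀ {V⁺ M} (g : Grow y₁ V⁺) → Unique (covered M) →
                       (∀ {x} → x ∈ covered M → x ∈ W⁺ ⊎ x ∈ V⁺) → Unique (covered (extra g ++ M))
        extra-unique g@(needy _) uniq inside =
          ∷-unique (λ { (here refl) → u∉Y y₁∈Y
                      ; (there p) → Y-fresh g y₁∈Y (inside p) })
          (∷-unique (u-fresh g ∘ inside) uniq)
        extra-unique g@(full y₂∈Y y₂≢y₁) uniq inside =
          ∷-unique (λ { (here refl) → u∉Y y₁∈Y
                      ; (there (here refl)) → y₂≢y₁ refl
                      ; (there (there (here refl))) → v∉Y y₁∈Y
                      ; (there (there (there p))) → Y-fresh g y₁∈Y (inside p) })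
          (∷-unique (λ { (here refl) → u∉Y y₂∈Y
                       ; (there (here eq)) → u≢v eq
                       ; (there (there p)) → u-fresh g (inside p) })
          (∷-unique (λ { (here refl) → v∉Y y₂∈Y
                       ; (there p) → Y-fresh g y₂∈Y (inside p) })
          (∷-unique (λ p → [ v∉W⁺ , v∉V ]′ (inside p)) uniq)))

        module Extend {V⁺} (g : Grow y₁ V⁺) (C : Completion k h⁺ W⁺ V⁺) where
          private module C = Completion C

          -- The completion may attach nodes of `W⁺` to a needy `v`; the list of `v` must return
          -- these edges.
          att : List Node
          att = filter (λ w → v ∈? C.nbrs w) W⁺

          att⁻ : ∀ {w} → w ∈ att → w ∈ W⁺ × v ∈ C.nbrs w
          att⁻ = ∈-filter⁻ (λ w → v ∈? C.nbrs w) {xs = W⁺}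

          att⁺ : ∀ {w} → w ∈ W⁺ → v ∈ C.nbrs w → w ∈ att
          att⁺ = ∈-filter⁺ (λ w → v ∈? C.nbrs w)

          att-unique : Unique att
          att-unique = filter⁺ (λ w → v ∈? C.nbrs w) W⁺-unique

          -- A full `v` has the neighbours `u` and `Y`, and `Y` has fewer than `Δ` nodes. For a
          -- needy `v`, `Y` is a single node and `attached` allows `2 + k` further neighbours; the
          -- sum `4 + k` fits into `budget`.
          degree-v : length (u ∷ Y ++ att) ≤ Δ
          degree-v with spare g
          ... | inj₂ v∉V⁺ = begin
            suc (length (Y ++ att))      ≡⟨ cong suc (length-++ Y) ⟩
            suc (length Y + length att)  ≤⟨ s≤s (ℕ.+-monoʳ-≤ (length Y) att-empty) ⟩
            suc (length Y + 0)           ≡⟨ cong suc (ℕ.+-identityʳ _) ⟩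
            suc (length Y)               ≤⟨ Y-length ⟩
            Δ                            ∎
            where
            open ℕ.≤-Reasoning
            att-empty : length att ≤ 0
            att-empty = unique-⊆⇒length-≤ {ys = []} att-unique λ w∈att →
              let w∈W⁺ , v∈ = att⁻ w∈att
              in contradiction (C.nbrs-inside w∈W⁺ v∈) [ v∉W⁺ , v∉V⁺ ]′
          ... | inj₁ (one , v∈V⁺) = begin
            suc (length (Y ++ att))      ≡⟨ cong suc (length-++ Y) ⟩
            suc (length Y + length att)  ≡⟨ cong (λ z → suc (z + length att)) one ⟩
            2 + length att               ≤⟨ s≤s (s≤s att-bounded) ⟩
            3 + suc k                    ≤⟨ ℕ.m≤m+n (3 + suc k) (length V) ⟩
            3 + suc k + length V         ≤⟨ budget ⟩
            Δ                            ∎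
            where
            open ℕ.≤-Reasoning
            att-bounded : length att ≤ 2 + k
            att-bounded =
              let B , B-length , ∈B = C.attached v∈V⁺
              in ℕ.≤-trans (unique-⊆⇒length-≤ att-unique λ w∈att →
                   let w∈W⁺ , v∈ = att⁻ w∈att in ∈B w∈W⁺ v∈) B-length

          N N₁ N₂ : Node → List Node
          N₂ = override Y (const (u ∷ v ∷ [])) C.nbrs
          N₁ = override (v ∷ []) (const (u ∷ Y ++ att)) N₂
          N  = override (u ∷ []) (const l) N₁

          N-u : N u ≡ l
          N-u = override-∈ (u ∷ []) (const l) N₁ (here refl)

          N-v : N v ≡ u ∷ Y ++ att
          N-v = trans (override-∉ (u ∷ []) (const l) N₁ λ { (here v≡u) → u≢v (sym v≡u) })
                      (override-∈ (v ∷ []) (const (u ∷ Y ++ att)) N₂ (here refl))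

          N-else : ∀ {w} → w ≢ u → w ≢ v → N w ≡ N₂ w
          N-else w≢u w≢v = trans (override-∉ (u ∷ []) (const l) N₁ λ { (here w≡u) → w≢u w≡u })
                                 (override-∉ (v ∷ []) (const (u ∷ Y ++ att)) N₂ λ { (here w≡v) → w≢v w≡v })

          N-Y : ∀ {y} → y ∈ Y → N y ≡ u ∷ v ∷ []
          N-Y y∈Y = trans (N-else (λ { refl → u∉Y y∈Y }) (λ { refl → v∉Y y∈Y }))
                          (override-∈ Y (const (u ∷ v ∷ [])) C.nbrs y∈Y)

          N-W⁺ : ∀ {w} → w ∈ W⁺ → N w ≡ C.nbrs w
          N-W⁺ w∈W⁺ = trans (N-else (λ { refl → u∉W⁺ w∈W⁺ }) (λ { refl → v∉W⁺ w∈W⁺ }))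
                            (override-∉ Y (const (u ∷ v ∷ [])) C.nbrs λ w∈Y → Y∉W⁺ w∈Y w∈W⁺)

          widen : ∀ {i} → Admissible W⁺ V⁺ i → Admissible W V i
          widen (admissible w∈ uniq noloop inside degree choices) =
            admissible (W⁺⊆W w∈) uniq noloop (All.map widen-∈ inside) degree (Two-mono W⁺⊆W choices)
            where
            widen-∈ : ∀ {x} → x ∈ W⁺ ⊎ x ∈ V⁺ → x ∈ W ⊎ x ∈ V
            widen-∈ (inj₁ p) = inj₁ (W⁺⊆W p)
            widen-∈ (inj₂ p) with V⁺⊆ g p
            ... | here refl = inj₁ v∈W
            ... | there q   = inj₂ q

          permit : ∀ {w l} → N w ≡ l → Admissible W V (w , l) → N w ≡ [] ⊎ Admissible W V (w , N w)
          permit {w} eq = inj₂ ∘ subst (λ l → Admissible W V (w , l)) (sym eq)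

          -- The lists must already be admissible when `u` is revealed, as `received` demands. At
          -- that moment `u` and `v` are unmatched, so they are the two choices for a node of `Y`,
          -- while `u` and `y₁` are those for `v`.
          permitted : ∀ {w} → w ∈ W → N w ≡ [] ⊎ Admissible W V (w , N w)
          permitted w∈W with part w∈W
          ... | is-u refl = permit N-u adm
          ... | is-v refl = permit N-v (admissible v∈W
            (∷-unique (λ u∈ → [ u∉Y , u∉W⁺ ∘ proj₁ ∘ att⁻ ]′ (∈-++⁻ Y u∈))
              (++⁺ Y-unique att-unique λ (p , q) → Y∉W⁺ p (proj₁ (att⁻ q))))
            (λ { (here v≡u) → u≢v (sym v≡u) ; (there p) → [ v∉Y , v∉W⁺ ∘ proj₁ ∘ att⁻ ]′ (∈-++⁻ Y p) })
            (inj₁ u∈W ∷ All.tabulate λ p → inj₁ ([ Y⊆W , W⁺⊆W ∘ proj₁ ∘ att⁻ ]′ (∈-++⁻ Y p)))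
            degree-v
            (two (λ { refl → u∉Y y₁∈Y }) u∈W (Y⊆W y₁∈Y) (here refl) (there (∈-++⁺ˡ y₁∈Y))))
          ... | in-Y y∈Y = permit (N-Y y∈Y) (admissible (Y⊆W y∈Y)
            (∷-unique (λ { (here eq) → u≢v eq }) ([] ∷ []))
            (λ { (here refl) → u∉Y y∈Y ; (there (here refl)) → v∉Y y∈Y })
            (inj₁ u∈W ∷ inj₁ v∈W ∷ [])
            (ℕ.≤-trans (s≤s (s≤s z≤n)) budget)
            (two u≢v u∈W v∈W (here refl) (there (here refl))))
          ... | in-W⁺ w∈W⁺ with C.permitted w∈W⁺
          ...   | inj₁ empty = inj₁ (trans (N-W⁺ w∈W⁺) empty)
          ...   | inj₂ adm⁺  = permit (N-W⁺ w∈W⁺) (widen adm⁺)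

          ∈N : ∀ {w x l} → N w ≡ l → x ∈ l → x ∈ N w
          ∈N eq = subst (_ ∈_) (sym eq)

          ∈N⁻ : ∀ {w x l} → N w ≡ l → x ∈ N w → x ∈ l
          ∈N⁻ eq = subst (_ ∈_) eq

          symm : ∀ {w x} → w ∈ W → x ∈ W → x ∈ N w → w ∈ N x
          symm w∈W x∈W x∈ with part w∈W
          ... | is-u refl with l∩W (∈N⁻ N-u x∈) x∈W
          ...   | inj₁ refl = ∈N N-v (here refl)
          ...   | inj₂ x∈Y  = ∈N (N-Y x∈Y) (here refl)
          symm w∈W x∈W x∈ | is-v refl with ∈N⁻ N-v x∈
          ... | here refl = ∈N N-u v∈l
          ... | there p with ∈-++⁻ Y p
          ...   | inj₁ x∈Y   = ∈N (N-Y x∈Y) (there (here refl))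
          ...   | inj₂ x∈att = let x∈W⁺ , v∈ = att⁻ x∈att in ∈N (N-W⁺ x∈W⁺) v∈
          symm w∈W x∈W x∈ | in-Y w∈Y with ∈N⁻ (N-Y w∈Y) x∈
          ... | here refl         = ∈N N-u (Y⊆l w∈Y)
          ... | there (here refl) = ∈N N-v (there (∈-++⁺ˡ w∈Y))
          symm w∈W x∈W x∈ | in-W⁺ w∈W⁺ with ∈N⁻ (N-W⁺ w∈W⁺) x∈
          ... | x∈C with C.nbrs-inside w∈W⁺ x∈C
          ...   | inj₁ x∈W⁺ = ∈N (N-W⁺ x∈W⁺) (C.symm w∈W⁺ x∈W⁺ x∈C)
          ...   | inj₂ x∈V⁺ with V⁺⊆ g x∈V⁺
          ...     | here refl = ∈N N-v (there (∈-++⁺ʳ Y (att⁺ w∈W⁺ x∈C)))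
          ...     | there x∈V = contradiction x∈V (alive⇒¬needy x∈W)

          attached : ∀ {x} → x ∈ V → ∃[ B ] (length B ≤ 3 + k × (∀ {w} → w ∈ W → x ∈ N w → w ∈ B))
          attached {x} x∈V with C.attached (V⊆V⁺ g x∈V)
          -- The list `l` comes from the algorithm's priorities and may contain any needy node, so
          -- `u` is added to the bound; `v` and `Y` have no neighbours in `V`.
          ... | B , B-length , ∈B = u ∷ B , s≤s B-length , holds
            where
            x∉W : x ∉ W
            x∉W x∈W = alive⇒¬needy x∈W x∈V
            holds : ∀ {w} → w ∈ W → x ∈ N w → w ∈ u ∷ B
            holds w∈W x∈ with part w∈W
            ... | is-u refl = here refl
            ... | in-W⁺ w∈W⁺ = there (∈B w∈W⁺ (∈N⁻ (N-W⁺ w∈W⁺) x∈))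
            ... | in-Y w∈Y with ∈N⁻ (N-Y w∈Y) x∈
            ...   | here refl         = contradiction u∈W x∉W
            ...   | there (here refl) = contradiction v∈W x∉W
            holds w∈W x∈ | is-v refl with ∈N⁻ N-v x∈
            ... | here refl = contradiction u∈W x∉W
            ... | there p   = contradiction ([ Y⊆W , W⁺⊆W ∘ proj₁ ∘ att⁻ ]′ (∈-++⁻ Y p)) x∉W

          covers : ∀ {w x} → w ∈ W → x ∈ N w → w ∈ u ∷ v ∷ C.cover ⊎ x ∈ u ∷ v ∷ C.cover ⊎ x ∈ V
          covers w∈W x∈ with part w∈W
          ... | is-u refl = inj₁ (here refl)
          ... | is-v refl = inj₁ (there (here refl))
          ... | in-Y w∈Y with ∈N⁻ (N-Y w∈Y) x∈
          ...   | here refl         = inj₂ (inj₁ (here refl))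
          ...   | there (here refl) = inj₂ (inj₁ (there (here refl)))
          covers w∈W x∈ | in-W⁺ w∈W⁺ with C.covers w∈W⁺ (∈N⁻ (N-W⁺ w∈W⁺) x∈)
          ... | inj₁ p        = inj₁ (there (there p))
          ... | inj₂ (inj₁ p) = inj₂ (inj₁ (there (there p)))
          ... | inj₂ (inj₂ p) with V⁺⊆ g p
          -- A needy `v` enters the cover here and takes care of the edges that the completion left
          -- to `V⁺`.
          ...   | here refl = inj₂ (inj₁ (there (here refl)))
          ...   | there q   = inj₂ (inj₂ q)

          isolated⁺ : ∀ {G} → (∀ {w} → w ∈ W → neighbors G w ≡ N w) →
            (∀ {w} → w ∉ W → Isolated (matching h) (item G w)) →
            ∀ {w} → w ∉ W⁺ → Isolated (matching h⁺) (item G w)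
          isolated⁺ agree isolated {w} w∉W⁺ with w ∈? W
          ... | no w∉W = Isolated-mono {M = matching h} (isolated w∉W)
          ... | yes w∈W with part w∈W
          ...   | is-u refl  = inj₁ (here refl)
          ...   | is-v refl  = inj₁ (there (here refl))
          ...   | in-W⁺ w∈W⁺ = contradiction w∈W⁺ w∉W⁺
          -- Both neighbours of a node in `Y` are now matched, so this gadget yields a single edge
          -- for the algorithm.
          ...   | in-Y w∈Y   = inj₂ (subst (All _) (sym (trans (agree w∈W) (N-Y w∈Y)))
                                 (here refl ∷ there (here refl) ∷ []))

          completion : Completion (suc k) h W V
          completion = record
            { nbrs            = N
            ; permitted       = permitted
            ; symm            = symm
            ; attached        = attached
            ; optimum         = extra g ++ C.optimum
            ; optimum-edges   = All++⁺
                (extra-edges g (λ y∈Y → Y⊆W y∈Y , ∈N (N-Y y∈Y) (here refl))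
                               (λ y∈Y → Y⊆W y∈Y , ∈N (N-Y y∈Y) (there (here refl))))
                (All.map (λ (a∈W⁺ , b∈) → W⁺⊆W a∈W⁺ , ∈N (N-W⁺ a∈W⁺) b∈) C.optimum-edges)
            ; optimum-unique  = extra-unique g C.optimum-unique C.optimum-inside
            ; optimum-length  = optimum-length
            ; cover           = u ∷ v ∷ C.cover
            ; cover-length    = trans (cong (2 +_) C.cover-length) (cong (λ z → 4 + z) (sym (ℕ.+-suc k k)))
            ; covers          = covers
            ; final           = C.final
            ; final-length    = trans C.final-length (ℕ.+-suc (2 + k) (length h))
            ; run             = λ {G} agree isolated →
                Run-step {G} (trans (agree u∈W) N-u) (received {G = G} N-u permitted agree isolated)
                  (C.run (λ w∈W⁺ → trans (agree (W⁺⊆W w∈W⁺)) (N-W⁺ w∈W⁺)) (isolated⁺ {G} agree isolated))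
            }
            where
            open ≡-Reasoning
            optimum-length : length (extra g ++ C.optimum) ≡ 3 + (suc k + suc k) + length V
            optimum-length = begin
              length (extra g ++ C.optimum)                      ≡⟨ length-++ (extra g) ⟩
              length (extra g) + length C.optimum                ≡⟨ cong (length (extra g) +_) C.optimum-length ⟩
              length (extra g) + (3 + (k + k) + length V⁺)       ≡⟨ lemma₁ (length (extra g)) k (length V⁺) ⟩
              3 + (k + k) + (length (extra g) + length V⁺)       ≡⟨ cong (3 + (k + k) +_) (extra-length g) ⟩
              3 + (k + k) + (2 + length V)                       ≡⟨ lemma₂ k (length V) ⟩
              3 + (suc k + suc k) + length V                     ∎
              where
              lemma₁ : ∀ e k w → e + (3 + (k + k) + w) ≡ 3 + (k + k) + (e + w)
              lemma₁ = solve-∀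
              lemma₂ : ∀ k w → 3 + (k + k) + (2 + w) ≡ 3 + (suc k + suc k) + w
              lemma₂ = solve-∀

      early : (∀ {h W V} → State k h W V → Completion k h W V) → Completion (suc k) h W V
      early complete with Y-nonempty
      ... | y₁ , y₁∈Y with singleton-or-pair Y-unique y₁∈Y
      ...   | inj₁ one = Extend.completion y₁∈Y (needy one) (complete (next y₁∈Y (needy one)))
      ...   | inj₂ (y₂ , y₂∈Y , y₂≢y₁) =
        Extend.completion y₁∈Y (full y₂∈Y y₂≢y₁) (complete (next y₁∈Y (full y₂∈Y y₂≢y₁)))

    -- The last gadget: a star

    module Last {h W V} (S : State 0 h W V) {u l} (adm : Admissible W V (u , l))
                (top : ∀ {j} → Admissible W V j → Lower h j (u , l)) where
      open State S
      open Admissible adm renaming (alive to u∈W; uniq to l-unique; noloop to u∉l)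
      open Reception S adm top

      record Plan : Set where
        field
          t             : Node
          Q             : List Node
          t∈W⁺          : t ∈ W⁺
          Q⊆W⁺          : Q ⊆ W⁺
          Q-unique      : Unique Q
          t∉Q           : t ∉ Q
          leaves-length : length Y + length Q ≡ Δ
          chosen        : Picks Y Q (length V)

      plan : Plan
      -- One node serves as the centre `t`; the other `Δ ∸ length Y` bring the number of leaves up
      -- to `Δ`.
      plan with choose-sublist (suc (Δ ∸ length Y)) W⁺-unique enough
        where
        open ℕ.≤-Reasoning
        enough : suc (Δ ∸ length Y) ≤ length W⁺
        enough = begin
          suc (Δ ∸ length Y)   ≡⟨ ℕ.+-∸-assoc 1 (ℕ.<⇒≤ Y-length) ⟨
          suc Δ ∸ length Y     ≤⟨ ℕ.m≤n+o⇒m∸n≤o (suc Δ) (length Y)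
                                    (ℕ.+-cancelˡ-≤ 2 _ _ (ℕ.≤-trans supply W⁺-length)) ⟩
          length W⁺            ∎
      ... | t ∷ Q , sub , uniq@(_ ∷ Q-unique) , eq = record
        { t = t ; Q = Q
        ; t∈W⁺ = sub (here refl)
        ; Q⊆W⁺ = sub ∘ there
        ; Q-unique = Q-unique
        ; t∉Q = Unique[x∷xs]⇒x∉xs uniq
        ; leaves-length = leaves-length
        -- `Q` is nonempty because `Y` has fewer than `Δ` nodes, and `budget` with `k` equal to 0
        -- provides `3 + length V` leaves.
        ; chosen = picks Y-unique Q-unique (λ y∈Y y∈Q → Y∉W⁺ y∈Y (sub (there y∈Q)))
            (∈-length (proj₂ Y-nonempty)) (subst (0 <_) (sym (ℕ.suc-injective eq)) (ℕ.m<n⇒0<n∸m Y-length))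
            (subst (3 + length V ≤_) (sym leaves-length) budget)
        }
        where
        leaves-length : length Y + length Q ≡ Δ
        leaves-length = trans (cong (length Y +_) (ℕ.suc-injective eq)) (ℕ.m+[n∸m]≡n (ℕ.<⇒≤ Y-length))

      module Star (thePlan : Plan) where
        open Plan thePlan
        open Picks chosen renaming (x₁ to y₁; y₁ to q₁; z to m; x₁∈xs to y₁∈Y; y₁∈ys to q₁∈Q; z∈ to m∈)

        leaves : List Node
        leaves = Y ++ Q

        t∈W : t ∈ W
        t∈W = W⁺⊆W t∈W⁺

        Q⊆W : Q ⊆ W
        Q⊆W = W⁺⊆W ∘ Q⊆W⁺

        leaves⊆W : leaves ⊆ W
        leaves⊆W p = [ Y⊆W , Q⊆W ]′ (∈-++⁻ Y p)

        leaves-unique : Unique leaves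
        leaves-unique = ++⁺ Y-unique Q-unique λ (p , q) → Y∉W⁺ p (Q⊆W⁺ q)

        u∉leaves : u ∉ leaves
        u∉leaves p = [ u∉Y , u∉W⁺ ∘ Q⊆W⁺ ]′ (∈-++⁻ Y p)

        v∉leaves : v ∉ leaves
        v∉leaves p = [ v∉Y , v∉W⁺ ∘ Q⊆W⁺ ]′ (∈-++⁻ Y p)

        t∉leaves : t ∉ leaves
        t∉leaves p = [ (λ t∈Y → Y∉W⁺ t∈Y t∈W⁺) , t∉Q ]′ (∈-++⁻ Y p)

        u≢t : u ≢ t
        u≢t = ≢-sym (∈-∉⇒≢ t∈W⁺ u∉W⁺)

        v≢t : v ≢ t
        v≢t = ≢-sym (∈-∉⇒≢ t∈W⁺ v∉W⁺)

        P : Node → List Node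
        P = partner rest V

        -- The default `const []` isolates every node of `W` outside the gadget from the start.
        N N₁ N₂ N₃ N₄ : Node → List Node
        N₄ = override Q (λ x → v ∷ t ∷ P x) (const [])
        N₃ = override Y (λ x → u ∷ t ∷ P x) N₄
        N₂ = override (t ∷ []) (const leaves) N₃
        N₁ = override (v ∷ []) (const (u ∷ Q)) N₂
        N  = override (u ∷ []) (const l) N₁

        N-u : N u ≡ l
        N-u = override-∈ _ _ _ (here refl)

        N-v : N v ≡ u ∷ Q
        N-v = trans (override-∉ _ _ _ λ { (here v≡u) → u≢v (sym v≡u) }) (override-∈ _ _ _ (here refl))

        N₂-else : ∀ {w} → w ≢ u → w ≢ v → N w ≡ N₂ w
        N₂-else w≢u w≢v = trans (override-∉ _ _ _ λ { (here w≡u) → w≢u w≡u })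
                                (override-∉ _ _ _ λ { (here w≡v) → w≢v w≡v })

        N-t : N t ≡ leaves
        N-t = trans (N₂-else (≢-sym u≢t) (≢-sym v≢t)) (override-∈ _ _ _ (here refl))

        N₃-else : ∀ {w} → w ≢ u → w ≢ v → w ≢ t → N w ≡ N₃ w
        N₃-else w≢u w≢v w≢t = trans (N₂-else w≢u w≢v) (override-∉ _ _ _ λ { (here w≡t) → w≢t w≡t })

        N₃-leaf : ∀ {w} → w ∈ leaves → N w ≡ N₃ w
        N₃-leaf p = N₃-else (λ { refl → u∉leaves p }) (λ { refl → v∉leaves p }) (λ { refl → t∉leaves p })

        N-Y : ∀ {y} → y ∈ Y → N y ≡ u ∷ t ∷ P y
        N-Y y∈Y = trans (N₃-leaf (∈-++⁺ˡ y∈Y)) (override-∈ _ _ _ y∈Y)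

        N-Q : ∀ {q} → q ∈ Q → N q ≡ v ∷ t ∷ P q
        N-Q q∈Q = trans (N₃-leaf (∈-++⁺ʳ Y q∈Q))
          (trans (override-∉ _ _ _ λ q∈Y → Y∉W⁺ q∈Y (Q⊆W⁺ q∈Q)) (override-∈ _ _ _ q∈Q))

        ∈N : ∀ {w x l} → N w ≡ l → x ∈ l → x ∈ N w
        ∈N eq = subst (_ ∈_) (sym eq)

        ∈N⁻ : ∀ {w x l} → N w ≡ l → x ∈ N w → x ∈ l
        ∈N⁻ eq = subst (_ ∈_) eq

        -- The constructor `leaf` treats `Y` and `Q` alike: `c` is `u` for a leaf in `Y` and `v` for
        -- one in `Q`, and either is matched after this step.
        data Role (w : Node) : Set where
          is-u : w ≡ u → Role w
          is-v : w ≡ v → Role w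
          is-t : w ≡ t → Role w
          leaf : ∀ {c} → c ∈ u ∷ v ∷ [] → w ∈ N c → w ∈ leaves → N w ≡ c ∷ t ∷ P w → Role w
          idle : N w ≡ [] → Role w

        leaf-role : ∀ {w} → w ∈ leaves → Role w
        leaf-role p with ∈-++⁻ Y p
        ... | inj₁ w∈Y = leaf (here refl) (∈N N-u (Y⊆l w∈Y)) p (N-Y w∈Y)
        ... | inj₂ w∈Q = leaf (there (here refl)) (∈N N-v (there w∈Q)) p (N-Q w∈Q)

        role : ∀ {w} → w ∈ W → Role w
        role {w} w∈W with part w∈W
        ... | is-u eq  = is-u eq
        ... | is-v eq  = is-v eq
        ... | in-Y w∈Y = leaf-role (∈-++⁺ˡ w∈Y)
        ... | in-W⁺ w∈W⁺ with w ≟ t | w ∈? Q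
        ...   | yes eq | _       = is-t eq
        ...   | no _   | yes w∈Q = leaf-role (∈-++⁺ʳ Y w∈Q)
        ...   | no w≢t | no w∉Q  = idle
          (trans (N₃-else (λ { refl → u∉W⁺ w∈W⁺ }) (λ { refl → v∉W⁺ w∈W⁺ }) w≢t)
          (trans (override-∉ _ _ _ λ w∈Y → Y∉W⁺ w∈Y w∈W⁺) (override-∉ _ _ _ w∉Q)))

        centre∈W : ∀ {c} → c ∈ u ∷ v ∷ [] → c ∈ W
        centre∈W (here refl)         = u∈W
        centre∈W (there (here refl)) = v∈W

        centre∉leaves : ∀ {c} → c ∈ u ∷ v ∷ [] → c ∉ leaves
        centre∉leaves (here refl)         = u∉leaves
        centre∉leaves (there (here refl)) = v∉leaves

        centre≢t : ∀ {c} → c ∈ u ∷ v ∷ [] → c ≢ t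
        centre≢t (here refl)         = u≢t
        centre≢t (there (here refl)) = v≢t

        P⊆V : ∀ {w} → P w ⊆ V
        P⊆V = partner-⊆ rest V _

        P∌ : ∀ {w x} → x ∈ W → x ∉ P w
        P∌ x∈W = alive⇒¬needy x∈W ∘ P⊆V

        permit : ∀ {w l} → N w ≡ l → Admissible W V (w , l) → N w ≡ [] ⊎ Admissible W V (w , N w)
        permit {w} eq = inj₂ ∘ subst (λ l → Admissible W V (w , l)) (sym eq)

        permitted : ∀ {w} → w ∈ W → N w ≡ [] ⊎ Admissible W V (w , N w)
        permitted w∈W with role w∈W
        ... | idle empty = inj₁ empty
        ... | is-u refl  = permit N-u adm
        ... | is-v refl  = permit N-v (admissible v∈W
          (∷-unique (u∉leaves ∘ ∈-++⁺ʳ Y) Q-unique)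
          (λ { (here v≡u) → u≢v (sym v≡u) ; (there p) → v∉leaves (∈-++⁺ʳ Y p) })
          (inj₁ u∈W ∷ All.tabulate (inj₁ ∘ Q⊆W))
          -- `Y` has at least one node, so `u` and `Q` together are no more than the `Δ` leaves.
          (subst (suc (length Q) ≤_) leaves-length (ℕ.+-monoˡ-≤ (length Q) (∈-length y₁∈Y)))
          (two (≢-sym (∈-∉⇒≢ (∈-++⁺ʳ Y q₁∈Q) u∉leaves)) u∈W (Q⊆W q₁∈Q) (here refl) (there q₁∈Q)))
        ... | is-t refl  = permit N-t (admissible t∈W leaves-unique t∉leaves
          (All.tabulate (inj₁ ∘ leaves⊆W))
          (ℕ.≤-reflexive (trans (length-++ Y) leaves-length))
          (two (≢-sym (∈-∉⇒≢ (Q⊆W⁺ q₁∈Q) (Y∉W⁺ y₁∈Y))) (Y⊆W y₁∈Y) (Q⊆W q₁∈Q) (∈-++⁺ˡ y₁∈Y) (∈-++⁺ʳ Y q₁∈Q)))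
        ... | leaf {c} c∈ _ w∈ eq = permit eq (admissible w∈W
          (∷-unique (λ { (here c≡t) → centre≢t c∈ c≡t ; (there p) → P∌ (centre∈W c∈) p })
            (∷-unique (P∌ t∈W) (partner-unique rest V _)))
          (λ { (here refl) → centre∉leaves c∈ w∈ ; (there (here refl)) → t∉leaves w∈ ; (there (there p)) → P∌ w∈W p })
          (inj₁ (centre∈W c∈) ∷ inj₁ t∈W ∷ All.tabulate (inj₂ ∘ P⊆V))
          (ℕ.≤-trans (s≤s (s≤s (partner-length rest V _))) (ℕ.≤-trans (ℕ.m≤m+n 3 (length V)) budget))
          (two (centre≢t c∈) (centre∈W c∈) t∈W (here refl) (there (here refl))))

        t∈N-leaf : ∀ {w} → w ∈ leaves → t ∈ N w
        t∈N-leaf p with ∈-++⁻ Y p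
        ... | inj₁ w∈Y = ∈N (N-Y w∈Y) (there (here refl))
        ... | inj₂ w∈Q = ∈N (N-Q w∈Q) (there (here refl))

        symm : ∀ {w x} → w ∈ W → x ∈ W → x ∈ N w → w ∈ N x
        symm w∈W x∈W x∈ with role w∈W
        ... | idle empty = contradiction (∈N⁻ empty x∈) λ ()
        ... | is-t refl  = t∈N-leaf (∈N⁻ N-t x∈)
        ... | is-u refl with l∩W (∈N⁻ N-u x∈) x∈W
        ...   | inj₁ refl = ∈N N-v (here refl)
        ...   | inj₂ x∈Y  = ∈N (N-Y x∈Y) (here refl)
        symm w∈W x∈W x∈ | is-v refl with ∈N⁻ N-v x∈
        ... | here refl = ∈N N-u v∈l
        ... | there x∈Q = ∈N (N-Q x∈Q) (here refl)
        symm w∈W x∈W x∈ | leaf c∈ w∈N w∈ eq with ∈N⁻ eq x∈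
        ... | here refl         = w∈N
        ... | there (here refl) = ∈N N-t w∈
        ... | there (there p)   = contradiction p (P∌ x∈W)

        -- A needy node can occur in `l`, which is arbitrary, and in the list of the one leaf paired
        -- with it; `v` and `t` list nodes of `W` alone.
        attached : ∀ {x} → x ∈ V → ∃[ B ] (length B ≤ 2 × (∀ {w} → w ∈ W → x ∈ N w → w ∈ B))
        attached {x} x∈V with partner-source rest needy-unique x∈V
        ... | r , only = u ∷ r ∷ [] , ℕ.≤-refl , holds
          where
          x∉W : x ∉ W
          x∉W x∈W = alive⇒¬needy x∈W x∈V
          holds : ∀ {w} → w ∈ W → x ∈ N w → w ∈ u ∷ r ∷ []
          holds w∈W x∈ with role w∈W
          ... | idle empty = contradiction (∈N⁻ empty x∈) λ ()
          ... | is-u refl  = here refl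
          ... | is-t refl  = contradiction (leaves⊆W (∈N⁻ N-t x∈)) x∉W
          ... | is-v refl with ∈N⁻ N-v x∈
          ...   | here refl = contradiction u∈W x∉W
          ...   | there p   = contradiction (Q⊆W p) x∉W
          holds w∈W x∈ | leaf c∈ _ _ eq with ∈N⁻ eq x∈
          ... | here refl         = contradiction (centre∈W c∈) x∉W
          ... | there (here refl) = contradiction t∈W x∉W
          ... | there (there p)   = there (here (only p))

        covers : ∀ {w x} → w ∈ W → x ∈ N w → w ∈ u ∷ v ∷ t ∷ [] ⊎ x ∈ u ∷ v ∷ t ∷ [] ⊎ x ∈ V
        covers w∈W x∈ with role w∈W
        ... | idle empty = contradiction (∈N⁻ empty x∈) λ ()
        ... | is-u refl  = inj₁ (here refl)
        ... | is-v refl  = inj₁ (there (here refl))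
        ... | is-t refl  = inj₁ (there (there (here refl)))
        ... | leaf c∈ _ _ eq with ∈N⁻ eq x∈
        ...   | here refl         = inj₂ (inj₁ (∈-++⁺ˡ c∈))
        ...   | there (here refl) = inj₂ (inj₁ (there (there (here refl))))
        ...   | there (there p)   = inj₂ (inj₂ (P⊆V p))

        -- Each of `u`, `v`, `t` and the needy nodes gets a leaf of its own, which meets the bound
        -- from the cover by `u`, `v`, `t` and `V`.
        optimum : List (Edge n)
        optimum = (y₁ , u) ∷ (q₁ , v) ∷ (m , t) ∷ zip rest V

        optimum-unique : Unique (covered optimum)
        optimum-unique with unique
        ... | y₁≢ ∷ q₁≢ ∷ m≢ ∷ rest-unique =
          ∷-unique (λ { (here eq) → ∈-∉⇒≢ (∈-++⁺ˡ y₁∈Y) u∉leaves eq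
                      ; (there (here eq)) → All¬⇒¬Any y₁≢ (here eq)
                      ; (there (there (here eq))) → ∈-∉⇒≢ (∈-++⁺ˡ y₁∈Y) v∉leaves eq
                      ; (there (there (there (here eq)))) → All¬⇒¬Any y₁≢ (there (here eq))
                      ; (there (there (there (there (here eq))))) → ∈-∉⇒≢ (∈-++⁺ˡ y₁∈Y) t∉leaves eq
                      ; (there (there (there (there (there p))))) →
                          apart (Y⊆W y₁∈Y) (All¬⇒¬Any y₁≢ ∘ there ∘ there) p })
          (∷-unique (λ { (here eq) → ∈-∉⇒≢ (∈-++⁺ʳ Y q₁∈Q) u∉leaves (sym eq)
                       ; (there (here eq)) → u≢v eq
                       ; (there (there (here eq))) → ∈-∉⇒≢ m∈ u∉leaves (sym eq)
                       ; (there (there (there (here eq)))) → u≢t eq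
                       ; (there (there (there (there p)))) → apart u∈W (u∉leaves ∘ rest⊆) p })
          (∷-unique (λ { (here eq) → ∈-∉⇒≢ (∈-++⁺ʳ Y q₁∈Q) v∉leaves eq
                       ; (there (here eq)) → All¬⇒¬Any q₁≢ (here eq)
                       ; (there (there (here eq))) → ∈-∉⇒≢ (∈-++⁺ʳ Y q₁∈Q) t∉leaves eq
                       ; (there (there (there p))) →
                           apart (Q⊆W q₁∈Q) (All¬⇒¬Any q₁≢ ∘ there) p })
          (∷-unique (λ { (here eq) → ∈-∉⇒≢ m∈ v∉leaves (sym eq)
                       ; (there (here eq)) → v≢t eq
                       ; (there (there p)) → apart v∈W (v∉leaves ∘ rest⊆) p })
          (∷-unique (λ { (here eq) → ∈-∉⇒≢ m∈ t∉leaves eq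
                       ; (there p) → apart (leaves⊆W m∈) (All¬⇒¬Any m≢) p })
          (∷-unique (apart t∈W (t∉leaves ∘ rest⊆))
          (covered-zip-unique rest-unique needy-unique (alive⇒¬needy ∘ leaves⊆W ∘ rest⊆)))))))
          where
          apart : ∀ {x} → x ∈ W → x ∉ rest → x ∉ covered (zip rest V)
          apart x∈W x∉rest p = [ x∉rest , alive⇒¬needy x∈W ]′ (covered-zip-⊆ p)

        live⁺ : ∀ {x} → x ∈ t ∷ leaves → x ∉ covered (matching h⁺)
        live⁺ (here refl) = W⁺-uncovered t∈W⁺
        live⁺ (there p)   = uncovered⁺ (leaves⊆W p) (λ { refl → u∉leaves p }) (λ { refl → v∉leaves p })

        -- The centre still has the unmatched leaf `y₁`, and every leaf the unmatched `t`.
        star-live : ∀ {x} → x ∈ t ∷ leaves → ¬ Isolated (matching h⁺) (x , N x)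
        star-live p           (inj₁ q)  = live⁺ p q
        star-live (here refl) (inj₂ qs) = live⁺ (there (∈-++⁺ˡ y₁∈Y)) (All.lookup qs (∈N N-t (∈-++⁺ˡ y₁∈Y)))
        star-live (there p)   (inj₂ qs) = live⁺ (here refl) (All.lookup qs (t∈N-leaf p))

        -- The next item is found among the star's nodes, whose lists are already planned; `run`
        -- shows that all other nodes are isolated by then.
        star-top : ∃[ x ] (x ∈ t ∷ leaves × (∀ {w} → w ∈ t ∷ leaves → Lower h⁺ (w , N w) (x , N x)))
        star-top with greatest h⁺ (t , N t) (map (λ x → x , N x) leaves)
        ... | j , j∈ , top⁺ with ∈-map⁻ (λ x → x , N x) {xs = t ∷ leaves} j∈
        ...   | x , x∈ , refl = x , x∈ , λ w∈ → All.lookup top⁺ (∈-map⁺ (λ x → x , N x) {xs = t ∷ leaves} w∈)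

        z : Node
        z = proj₁ star-top

        z∈star : z ∈ t ∷ leaves
        z∈star = proj₁ (proj₂ star-top)

        final : History n
        final = ((z , N z) , choose h⁺ (z , N z)) ∷ h⁺

        centre-covered : ∀ {c} → c ∈ u ∷ v ∷ [] → c ∈ covered (matching h⁺)
        centre-covered = ∈-++⁺ˡ

        V-covered : ∀ {x} → x ∈ V → x ∈ covered (matching h⁺)
        V-covered = there ∘ there ∘ needy-covered

        -- Whichever item of the star is received, its edge uses up `t`: the other possible
        -- neighbours of a leaf, its `c` and a needy node, are matched already.
        t-matched : ∀ {x} → x ∈ t ∷ leaves → t ∈ x ∷ choose h⁺ (x , N x) ∷ []
        t-matched (here refl) = here refl
        t-matched {x} (there p) with choose-valid h⁺ x (N x) (star-live (there p)) | role (leaves⊆W p)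
        ... | c∈N , c∉ | leaf c∈ _ _ eq with ∈N⁻ eq c∈N
        ...   | here refl         = contradiction (centre-covered c∈) c∉
        ...   | there (here eq′)  = there (here (sym eq′))
        ...   | there (there q)   = contradiction (V-covered (P⊆V q)) c∉
        t-matched (there p) | _ | is-u refl = contradiction p u∉leaves
        t-matched (there p) | _ | is-v refl = contradiction p v∉leaves
        t-matched (there p) | _ | is-t refl = contradiction p t∉leaves
        t-matched (there p) | _ | idle empty = contradiction (∈N⁻ empty (t∈N-leaf p)) λ ()

        completion : Completion 0 h W V
        completion = record
          { nbrs            = N
          ; permitted       = permitted
          ; symm            = symm
          ; attached        = attached
          ; optimum         = optimum
          ; optimum-edges   =
              (Y⊆W y₁∈Y , ∈N (N-Y y₁∈Y) (here refl)) ∷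
              (Q⊆W q₁∈Q , ∈N (N-Q q₁∈Q) (here refl)) ∷
              (leaves⊆W m∈ , t∈N-leaf m∈) ∷
              All.map (λ (r∈ , v∈) → leaves⊆W (rest⊆ r∈) , P⊆N (rest⊆ r∈) v∈)
                      (partner-edges (AllPairs.tail (AllPairs.tail (AllPairs.tail unique))))
          ; optimum-unique  = optimum-unique
          ; optimum-length  = cong (3 +_) (length-zip rest V rest-length)
          ; cover           = u ∷ v ∷ t ∷ []
          ; cover-length    = refl
          ; covers          = covers
          ; final           = final
          ; final-length    = refl
          ; run             = run
          }
          where
          P⊆N : ∀ {w} → w ∈ leaves → P w ⊆ N w
          P⊆N p q with ∈-++⁻ Y p
          ... | inj₁ w∈Y = ∈N (N-Y w∈Y) (there (there q))
          ... | inj₂ w∈Q = ∈N (N-Q w∈Q) (there (there q))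

          run : ∀ {G} → (∀ {w} → w ∈ W → neighbors G w ≡ N w) →
                (∀ {w} → w ∉ W → Isolated (matching h) (item G w)) → Run A G h final
          run {G} agree isolated =
            Run-step {G} (trans (agree u∈W) N-u) (received {G = G} N-u permitted agree isolated)
              (Run-step {G} (agree z∈W) (¬isolated-z , λ w → highest (w ∈? W)) (halt λ w → done (w ∈? W)))
            where
            star⊆W : t ∷ leaves ⊆ W
            star⊆W (here refl) = t∈W
            star⊆W (there p)   = leaves⊆W p

            z∈W : z ∈ W
            z∈W = star⊆W z∈star

            ¬isolated-z : ¬ Isolated (matching h⁺) (item G z)
            ¬isolated-z = star-live z∈star ∘ subst (λ l → Isolated (matching h⁺) (z , l)) (agree z∈W)

            below : ∀ {w} → w ∈ t ∷ leaves → Lower h⁺ (item G w) (item G z)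
            below {w} w∈ = subst (λ l → Lower h⁺ (w , l) (item G z)) (sym (agree (star⊆W w∈)))
              (subst (λ l → Lower h⁺ (w , N w) (z , l)) (sym (agree z∈W)) (proj₂ (proj₂ star-top) w∈))

            all-covered : ∀ {M w l} → w ∈ W → N w ≡ l → All (_∈ covered M) l → Isolated M (item G w)
            all-covered w∈W eq = inj₂ ∘ subst (All _) (sym (trans (agree w∈W) eq))

            highest : ∀ {w} → Dec (w ∈ W) → ¬ Isolated (matching h⁺) (item G w) →
                      Lower h⁺ (item G w) (item G z)
            highest {w} (no w∉W) ¬iso =
              contradiction (Isolated-mono {M = matching h} (isolated w∉W)) ¬iso
            highest {w} (yes w∈W) ¬iso = go (role w∈W)
              where
              go : Role w → Lower h⁺ (item G w) (item G z)
              go (is-u eq)      = contradiction (inj₁ (here eq)) ¬iso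
              go (is-v eq)      = contradiction (inj₁ (there (here eq))) ¬iso
              go (is-t eq)      = below (here eq)
              go (leaf _ _ p _) = below (there p)
              go (idle empty)   = contradiction (all-covered {matching h⁺} w∈W empty []) ¬iso

            done : ∀ {w} → Dec (w ∈ W) → Isolated (matching final) (item G w)
            done (no w∉W) =
              Isolated-mono {M = matching h⁺} (Isolated-mono {M = matching h} (isolated w∉W))
            done {w} (yes w∈W) = go (role w∈W)
              where
              t-covered : t ∈ covered (matching final)
              t-covered = ∈-++⁺ˡ (t-matched z∈star)
              go : Role w → Isolated (matching final) (item G w)
              go (is-u eq)        = inj₁ (there (there (here eq)))
              go (is-v eq)        = inj₁ (there (there (there (here eq))))
              go (is-t refl)      = inj₁ t-covered
              go (idle empty)     = all-covered {matching final} w∈W empty []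
              -- With `t` matched, every neighbour of every leaf is matched, and the run halts one
              -- edge after `u` and `v`.
              go (leaf c∈ _ _ eq) = all-covered {matching final} w∈W eq
                (there (there (centre-covered c∈)) ∷ t-covered ∷
                 All.tabulate (there ∘ there ∘ V-covered ∘ P⊆V))

    -- Recursion over the steps

    some-admissible : ∀ {W V} → Unique W → 3 ≤ length W → 2 ≤ Δ → ∃[ i ] Admissible W V i
    some-admissible {a ∷ b ∷ c ∷ _} ((a≢b ∷ a≢c ∷ _) ∷ (b≢c ∷ _) ∷ _) (s≤s (s≤s (s≤s _))) 2≤Δ =
      (a , b ∷ c ∷ []) , admissible (here refl) ((b≢c ∷ []) ∷ [] ∷ [])
        (λ { (here a≡b) → a≢b a≡b ; (there (here a≡c)) → a≢c a≡c })
        (inj₁ (there (here refl)) ∷ inj₁ (there (there (here refl))) ∷ []) 2≤Δ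
        (two b≢c (there (here refl)) (there (there (here refl))) (here refl) (there (here refl)))

    highest-priority : ∀ {k h W V} → State k h W V →
      ∃₂ λ u l → Admissible W V (u , l) × (∀ {j} → Admissible W V j → Lower h j (u , l))
    highest-priority {k} {h} S =
      let open State S
          _ , adm = some-admissible alive-unique
            (ℕ.≤-trans (ℕ.≤-trans (ℕ.m≤m+n 3 Δ) (ℕ.m≤n+m (3 + Δ) (k * suc Δ))) supply)
            (ℕ.≤-trans (s≤s (s≤s z≤n)) budget)
          (u , l) , adm′ , top = greatest-admissible h adm
      in u , l , adm′ , top

    -- The algorithm is followed forwards and the graph is assembled on the way back, since the list
    -- of a needy `v` depends on the nodes that later gadgets attach to it.
    complete : ∀ k {h W V} → State k h W V → Completion k h W V
    complete zero S with highest-priority S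
    ... | _ , _ , adm , top = Last.Star.completion S adm top (Last.plan S adm top)
    complete (suc k) S with highest-priority S
    ... | _ , _ , adm , top = Early.early S adm top (complete k)

    initial : ∀ {k} → k * suc Δ + (3 + Δ) ≤ n → 3 + k ≤ Δ → State k [] (allFin n) []
    initial {k} enough 3+k≤Δ = record
      { alive-unique    = allFin⁺ n
      ; alive-uncovered = λ _ ()
      ; needy-unique    = []
      ; needy-covered   = λ ()
      ; supply          = subst (_ ≤_) (sym (length-tabulate {n = n} id)) enough
      ; budget          = subst (_≤ Δ) (sym (ℕ.+-identityʳ (3 + k))) 3+k≤Δ
      }

    -- The adversary's graph and its maximum matching

    module Instance {k} (C : Completion k [] (allFin n) []) where
      open Completion C

      graph : Graph n
      graph = record
        { neighbors = nbrs
        ; distinct  = λ u → distinct′ (permitted (∈-allFin u))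
        ; loopless  = λ u → loopless′ (permitted (∈-allFin u))
        ; symmetric = symm (∈-allFin _) (∈-allFin _)
        }
        where
        distinct′ : ∀ {u l} → l ≡ [] ⊎ Admissible (allFin n) [] (u , l) → Unique l
        distinct′ (inj₁ refl) = []
        distinct′ (inj₂ adm)  = Admissible.uniq adm
        loopless′ : ∀ {u l} → l ≡ [] ⊎ Admissible (allFin n) [] (u , l) → u ∉ l
        loopless′ (inj₁ refl) = λ ()
        loopless′ (inj₂ adm)  = Admissible.noloop adm

      max-degree : MaxDegree≤ graph Δ
      max-degree u = bounded (permitted (∈-allFin u))
        where
        bounded : ∀ {l} → l ≡ [] ⊎ Admissible (allFin n) [] (u , l) → length l ≤ Δ
        bounded (inj₁ refl) = z≤n
        bounded (inj₂ adm)  = Admissible.degree adm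

      computes : Computes A graph (matching final)
      computes = final , run {graph} (λ _ → refl) (λ w∉ → contradiction (∈-allFin _) w∉) , refl

      computed-length : length (matching final) ≡ 2 + k
      computed-length = trans (length-map _ final) (trans final-length (ℕ.+-identityʳ (2 + k)))

      optimal-length : length optimum ≡ 3 + (k + k)
      optimal-length = trans optimum-length (ℕ.+-identityʳ (3 + (k + k)))

      -- With no needy nodes left over, `cover` meets every edge and has as many nodes as `optimum`
      -- has edges, so weak duality applies.
      optimal : IsMaximumMatching graph optimum
      optimal = (All.map proj₂ optimum-edges , optimum-unique) , λ M M-matching →
        subst (length M ≤_) (trans cover-length (sym optimal-length))
          (vertex-cover⇒length-≤ {graph} edge-covered M M-matching)
        where
        edge-covered : ∀ {w x} → x ∈ nbrs w → w ∈ cover ⊎ x ∈ cover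
        edge-covered x∈ with covers (∈-allFin _) x∈
        ... | inj₁ p        = inj₁ p
        ... | inj₂ (inj₁ p) = inj₂ p

-- The ratio

≤-scaled-ratio : ∀ a b .{{_ : NonZero b}} {ε} → ℚ.0ℚ ℚ.< ε →
                 ℤ.+ a ℚ./ 1 ℚ.≤ (ℤ.+ a ℚ./ b ℚ.+ ε) ℚ.* (ℤ.+ b ℚ./ 1)
≤-scaled-ratio a b@(suc d) {ε} 0<ε = begin
  -- The ratio is attained exactly; `ε` merely enlarges the right-hand side.
  ℤ.+ a ℚ./ 1                            ≡⟨ ℚ.toℚᵘ-injective exact ⟩
  (ℤ.+ a ℚ./ b) ℚ.* (ℤ.+ b ℚ./ 1)          ≤⟨ ℚ.*-monoʳ-≤-nonNeg (ℤ.+ b ℚ./ 1) {{ℚ.normalize-nonNeg b 1}} grow ⟩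
  (ℤ.+ a ℚ./ b ℚ.+ ε) ℚ.* (ℤ.+ b ℚ./ 1)    ∎
  where
  open ℚ.≤-Reasoning
  grow : ℤ.+ a ℚ./ b ℚ.≤ ℤ.+ a ℚ./ b ℚ.+ ε
  grow = subst (ℚ._≤ ℤ.+ a ℚ./ b ℚ.+ ε) (ℚ.+-identityʳ (ℤ.+ a ℚ./ b)) (ℚ.+-monoʳ-≤ (ℤ.+ a ℚ./ b) (ℚ.<⇒≤ 0<ε))
  cross : ∀ x y → x ℤ.* (y ℤ.* ℤ.1ℤ) ≡ x ℤ.* y ℤ.* ℤ.1ℤ
  cross = ℤ.solve-∀
  exact : ℚ.toℚᵘ (ℤ.+ a ℚ./ 1) ℚᵘ.≃ ℚ.toℚᵘ ((ℤ.+ a ℚ./ b) ℚ.* (ℤ.+ b ℚ./ 1))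
  exact =
    ℚᵘ.≃-trans (ℚ.toℚᵘ-fromℚᵘ (ℚᵘ.mkℚᵘ (ℤ.+ a) 0))
    (ℚᵘ.≃-trans (ℚᵘ.*≡* (cross (ℤ.+ a) (ℤ.+ b)))
    (ℚᵘ.≃-trans (ℚᵘ.≃-sym (ℚᵘ.*-cong (ℚ.toℚᵘ-fromℚᵘ (ℚᵘ.mkℚᵘ (ℤ.+ a) d)) (ℚ.toℚᵘ-fromℚᵘ (ℚᵘ.mkℚᵘ (ℤ.+ b) 0))))
    (ℚᵘ.≃-sym (ℚ.toℚᵘ-homo-* (ℤ.+ a ℚ./ b) (ℤ.+ b ℚ./ 1)))))

theorem3 : (Δ : ℕ) (3≤Δ : 3 ≤ Δ) (A : (n : ℕ) → PriorityAlgorithm n)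
    (ε : ℚ.ℚ) → ℚ.0ℚ ℚ.< ε →
    ∃[ n ] Σ[ G ∈ Graph n ] (MaxDegree≤ G Δ ×
    (∃[ M ] ∃[ M* ]
    (Computes (A n) G M × IsMaximumMatching G M* × 0 < length M* ×
    size M ℚ.≤ (ratio Δ 3≤Δ ℚ.+ ε) ℚ.* size M*)))
theorem3 Δ@(suc (suc (suc k))) 3≤Δ@(s≤s (s≤s (s≤s z≤n))) A ε 0<ε =
  n , graph , max-degree , matching final , optimum , computes , optimal ,
  subst (0 <_) (sym optimal-length) (s≤s z≤n) ,
  -- Here `Δ ∸ 1` computes to `2 + k`, the number of edges found by the algorithm, and `2 * Δ ∸ 3`
  -- to `k + (3 + (k + 0))`, which `doubled` identifies with the size of the optimum.
  subst₂ (λ a b → ℤ.+ a ℚ./ 1 ℚ.≤ (ratio Δ 3≤Δ ℚ.+ ε) ℚ.* (ℤ.+ b ℚ./ 1))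
    (sym computed-length) (trans (doubled k) (sym optimal-length))
    (≤-scaled-ratio (Δ ∸ 1) (2 * Δ ∸ 3) {{2Δ∸3-nonZero 3≤Δ}} 0<ε)
  where
  -- With `Δ` equal to `3 + k` there are `k` early steps; `supply` and `budget` then hold with
  -- equality at the start.
  n = k * suc Δ + (3 + Δ)
  C = Adversary.complete (A n) Δ k (Adversary.initial (A n) Δ ℕ.≤-refl ℕ.≤-refl)
  open Adversary.Completion C
  open Adversary.Instance (A n) Δ C
  doubled : ∀ k → k + (3 + (k + 0)) ≡ 3 + (k + k)
  doubled = solve-∀
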